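{- The problems $\textsc{Ccv}$, $\textsc{3vLfmm}$ and $\textsc{vLfmm}$ are equivalent under $\mathsf{AC}^0$ many-one reductions.
   Context: $\textsc{Ccv}$: given a comparator circuit (wires and a sequence of comparator gates, each mapping the values $(p,q)$ of two wires to $(p\wedge q,p\vee q)$), a Boolean input value for each wire and a designated wire, decide whether that wire outputs $1$. For a bipartite graph $G=(V,W,E)$ with bottom nodes $V=\{v_0,\dots,v_{m-1}\}$ and top nodes $W=\{w_0,\dots,w_{n-1}\}$, the lexicographically first maximal matching (lfm-matching) is obtained by processing $v_0,\dots,v_{m-1}$ in order and matching each to the least-indexed adjacent top node not yet matched (if any). $\textsc{vLfmm}$: given $G$ and a designated top node, decide whether it is matched in the lfm-matching. $\textsc{3vLfmm}$ is the restriction of $\textsc{vLfmm}$ to graphs of maximum degree at most three. $A$ is $\mathsf{AC}^0$ many-one reducible to $B$ if there is a uniform $\mathsf{AC}^0$ computable function $F$ with $A(X)\leftrightarrow B(F(X))$. -}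

module Defs where

open import Data.Nat using (ℕ; zero; suc; _+_; _*_; _≤_; _<_; _≤ᵇ_)
open import Data.Bool using (Bool; true; false; _∧_; _∨_; not; if_then_else_)
open import Data.Fin using (Fin; zero; suc; _≟_)
open import Data.Product using (Σ; _×_; _,_)
open import Data.List as L using (List; []; _∷_; _++_; length)
open import Data.Vec as V using (Vec; []; _∷_; lookup; _[_]≔_; toList; tabulate; transpose)
open import Data.Vec.Relation.Unary.All using (All)
open import Relation.Nullary using (does)
open import Relation.Binary.PropositionalEquality using (_≡_)
open import Function.Bundles using (_⇔_)

bitAt : List Bool → ℕ → Bool
bitAt []       _       = false
bitAt (b ∷ _)  zero    = b
bitAt (_ ∷ bs) (suc i) = bitAt bs i

-- Uniform AC⁰ via (two-sorted) Σ⁰_B / first-order logic with +, ×, ≤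
-- and bounded number quantifiers over a single input string X.
-- (FO[+,×] = DLOGTIME-uniform AC⁰, Barrington–Immerman–Straubing.)

data Term (k : ℕ) : Set where
  var  : Fin k → Term k
  lit  : ℕ → Term k
  len  : Term k
  _⊕_  : Term k → Term k → Term k
  _⊗_  : Term k → Term k → Term k

data Form (k : ℕ) : Set where
  leq  : Term k → Term k → Form k
  bit  : Term k → Form k
  neg  : Form k → Form k
  and  : Form k → Form k → Form k
  or   : Form k → Form k → Form k
  all< : Term k → Form (suc k) → Form k
  ex<  : Term k → Form (suc k) → Form k

evalT : ∀ {k} → Term k → Vec ℕ k → List Bool → ℕ
evalT (var i) ρ X = lookup ρ i
evalT (lit n) ρ X = n
evalT len     ρ X = length X
evalT (t ⊕ s) ρ X = evalT t ρ X + evalT s ρ X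
evalT (t ⊗ s) ρ X = evalT t ρ X * evalT s ρ X

allBelow : ℕ → (ℕ → Bool) → Bool
allBelow zero    p = true
allBelow (suc n) p = allBelow n p ∧ p n

exBelow : ℕ → (ℕ → Bool) → Bool
exBelow zero    p = false
exBelow (suc n) p = exBelow n p ∨ p n

evalF : ∀ {k} → Form k → Vec ℕ k → List Bool → Bool
evalF (leq t s)  ρ X = evalT t ρ X ≤ᵇ evalT s ρ X
evalF (bit t)    ρ X = bitAt X (evalT t ρ X)
evalF (neg φ)    ρ X = not (evalF φ ρ X)
evalF (and φ ψ)  ρ X = evalF φ ρ X ∧ evalF ψ ρ X
evalF (or φ ψ)   ρ X = evalF φ ρ X ∨ evalF ψ ρ X
evalF (all< t φ) ρ X = allBelow (evalT t ρ X) (λ x → evalF φ (x ∷ ρ) X)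
evalF (ex< t φ)  ρ X = exBelow  (evalT t ρ X) (λ x → evalF φ (x ∷ ρ) X)

-- F is a uniform AC⁰ function: polynomially bounded output length, and
-- both "i < |F(X)|" and the bit graph "F(X)(i)" are Σ⁰_B-definable.
IsAC0 : (List Bool → List Bool) → Set
IsAC0 F =
  Σ (Term 0) λ bound → Σ (Form 1) λ lenφ → Σ (Form 1) λ bitφ →
    (∀ X → length (F X) ≤ evalT bound [] X)
  × (∀ X i → (i < length (F X)) ⇔ (evalF lenφ (i ∷ []) X ≡ true))
  × (∀ X i → i < length (F X) → bitAt (F X) i ≡ evalF bitφ (i ∷ []) X)

Problem : Set₁
Problem = List Bool → Set

_≤AC0_ : Problem → Problem → Set
A ≤AC0 B = Σ (List Bool → List Bool) λ F → IsAC0 F × (∀ X → A X ⇔ B (F X))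

Gate : ℕ → Set
Gate m = Fin m × Fin m

applyGate : ∀ {m} → Vec Bool m → Gate m → Vec Bool m
applyGate v (i , j) = (v [ i ]≔ (lookup v i ∧ lookup v j)) [ j ]≔ (lookup v i ∨ lookup v j)

runCircuit : ∀ {m} → List (Gate m) → Vec Bool m → Vec Bool m
runCircuit []       v = v
runCircuit (g ∷ gs) v = runCircuit gs (applyGate v g)

oneHot : ∀ {n} → Fin n → List Bool
oneHot i = toList (tabulate (λ j → does (i ≟ j)))

encCcv : (m : ℕ) → List (Gate m) → Vec Bool m → Fin m → List Bool
encCcv m gs inp d =
  L.replicate m true ++ (false ∷ []) ++ toList inp ++ oneHot d
  ++ L.concatMap (λ { (i , j) → oneHot i ++ oneHot j }) gs

CCV : Problem
CCV X = Σ ℕ λ m → Σ (List (Gate m)) λ gs → Σ (Vec Bool m) λ inp → Σ (Fin m) λ d →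
  (X ≡ encCcv m gs inp d) × (lookup (runCircuit gs inp) d ≡ true)

-- Bipartite graphs: m bottom nodes v₀…v_{m-1}, n top nodes w₀…w_{n-1},
-- adjacency matrix adj (row = bottom node).

matchFirst : ∀ {n} → Vec Bool n → Vec Bool n → Vec Bool n
matchFirst []       []       = []
matchFirst (a ∷ as) (x ∷ xs) = if a ∧ not x then true ∷ xs else x ∷ matchFirst as xs

lfmStep : ∀ {m n} → Vec (Vec Bool n) m → Vec Bool n → Vec Bool n
lfmStep []           matched = matched
lfmStep (row ∷ rows) matched = lfmStep rows (matchFirst row matched)

lfmMatchedTop : ∀ {m n} → Vec (Vec Bool n) m → Vec Bool n
lfmMatchedTop adj = lfmStep adj (V.replicate _ false)

ones : ∀ {n} → Vec Bool n → ℕ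
ones []          = 0
ones (true ∷ v)  = suc (ones v)
ones (false ∷ v) = ones v

MaxDeg3 : ∀ {m n} → Vec (Vec Bool n) m → Set
MaxDeg3 adj = All (λ r → ones r ≤ 3) adj × All (λ c → ones c ≤ 3) (transpose adj)

encGraph : (m n : ℕ) → Vec (Vec Bool n) m → Fin n → List Bool
encGraph m n adj d =
  L.replicate m true ++ (false ∷ []) ++ L.replicate n true ++ (false ∷ [])
  ++ oneHot d ++ toList (V.concat adj)

VLFMM : Problem
VLFMM X = Σ ℕ λ m → Σ ℕ λ n → Σ (Vec (Vec Bool n) m) λ adj → Σ (Fin n) λ d →
  (X ≡ encGraph m n adj d) × (lookup (lfmMatchedTop adj) d ≡ true)

V3LFMM : Problem
V3LFMM X = Σ ℕ λ m → Σ ℕ λ n → Σ (Vec (Vec Bool n) m) λ adj → Σ (Fin n) λ d →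
  (X ≡ encGraph m n adj d) × MaxDeg3 adj × (lookup (lfmMatchedTop adj) d ≡ true)

_≡AC0_ : Problem → Problem → Set
A ≡AC0 B = (A ≤AC0 B) × (B ≤AC0 A)

{-# OPTIONS --safe #-}
module Submission where

-- A chain CCV ≤ 3vLFMM ≤ vLFMM ≤ CCV suffices, because first-order reductions compose: quantify
-- over the length of the intermediate string and replace each query to it by its defining formula.
--
-- vLFMM ≤ CCV: bottom nodes are wires with input 1, top nodes wires with input 0. Processing the
-- pairs (r , c) in order, an edge becomes the comparator sending the conjunction to r and the
-- disjunction to c, which moves the token of r to c iff c is still free. A non-edge becomes the
-- idle gate (r , r), so that the gates need not be counted.
--
-- CCV ≤ 3vLFMM: top nodes are arranged in layers 0 … 2G, one node per wire and layer; layer 2t holds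
-- the wire values before gate t ("matched" = 1). A row whose first neighbour is the value node
-- of wire w is pushed on to its next neighbour iff w carries 1. For gate (i , j) both rows i and j
-- are pushed to node j of the next layer, so it computes the disjunction; the later one of the two
-- is pushed further to node i two layers on iff both wires carry 1. The following layer of rows
-- copies all the other values, merging with that node.

open import Defs
open import Data.Bool using (Bool; true; false; _∧_; _∨_; not; if_then_else_)
open import Data.Bool.Properties using (T-≡; ¬-not; not-¬; ∧-identityʳ; ∧-zeroʳ; ∨-identityʳ; ∧-assoc; ∨-comm; ∨-idem; ∨-zeroʳ)
open import Data.Empty using (⊥-elim)
open import Data.Fin using (Fin; zero; suc; #_; toℕ; fromℕ<)
import Data.Fin as Fin
open import Data.Fin.Properties using (toℕ-injective; toℕ<n; toℕ-fromℕ<)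
open import Data.List using (List; []; _∷_; _++_; length; applyUpTo; concat; concatMap)
import Data.List as L
open import Data.List.Membership.Propositional using (_∈_)
open import Data.List.Membership.Propositional.Properties using (∈-map⁺; ∈-map⁻)
open import Data.List.Properties using (length-++; length-applyUpTo; length-replicate; length-tabulate; length-map)
open import Data.List.Relation.Unary.Any using (here; there)
open import Data.Nat
open import Data.Nat.Properties
open import Data.Nat.Tactic.RingSolver using (solve-∀)
open import Data.Product using (Σ; ∃; _×_; _,_; proj₁; proj₂)
open import Data.Sum using (_⊎_; inj₁; inj₂; [_,_])
import Data.Sum as Sum
open import Data.Vec using (Vec; []; _∷_; lookup; toList; tabulate; transpose)
import Data.Vec as V
import Data.Vec.Properties as Vₚ
open import Data.Vec.Relation.Unary.All.Properties using (lookup⁺; lookup⁻)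
open import Function using (_∘_; id; case_of_)
open import Function.Bundles using (_⇔_; mk⇔; Equivalence)
open import Relation.Binary.Definitions using (tri<; tri≈; tri>)
open import Relation.Binary.PropositionalEquality hiding ([_]; J)
open import Relation.Nullary using (¬_; Dec; yes; no; does)
open import Relation.Nullary.Decidable using (True; dec-true; dec-false; _×-dec_; _⊎-dec_)

open Equivalence using (to; from)

-- Two restrictions of the first-order setting shape the development. Formulas cannot count, so
-- every output is assembled from pieces whose lengths are terms in three numbers read off the
-- input; this is why each gate receives the same number of rows. And a reduction must answer on
-- every string: the three numbers are found by bounded quantifiers, unambiguously, and a string
-- that is no encoding goes to the empty string, a negative instance of each target problem. For the
-- same reason 3vLFMM ≤ vLFMM is more than an inclusion, since graphs of larger degree have to be
-- recognised and rejected.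
--
-- A gate gets two layers for two reasons. The node for the conjunction must come after the node for
-- the disjunction in the order of the top nodes, so it sits one layer further, and a gate in
-- between would read wire i before its value has arrived. Idle layers also keep the degree at
-- three: a node meets the row that copies into it and the row that reads it, which leaves room for
-- one redirected or one carried row, but not for both.

_⇔∘_ : {A B C : Set} → A ⇔ B → B ⇔ C → A ⇔ C
f ⇔∘ g = mk⇔ (to g ∘ to f) (from f ∘ from g)

⇔-sym : {A B : Set} → A ⇔ B → B ⇔ A
⇔-sym f = mk⇔ (from f) (to f)

-- Boolean tests as propositions

∧-true : ∀ {a b} → (a ∧ b ≡ true) ⇔ (a ≡ true × b ≡ true)
∧-true {true}  = mk⇔ (refl ,_) proj₂
∧-true {false} = mk⇔ (λ ()) (λ ())

∨-true : ∀ {a b} → (a ∨ b ≡ true) ⇔ (a ≡ true ⊎ b ≡ true)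
∨-true {true}  = mk⇔ inj₁ (λ _ → refl)
∨-true {false} = mk⇔ inj₂ [ (λ ()) , id ]

not-true : ∀ {a} → (not a ≡ true) ⇔ (¬ a ≡ true)
not-true {true}  = mk⇔ (λ ()) (λ f → ⊥-elim (f refl))
not-true {false} = mk⇔ (λ _ ()) (λ _ → refl)

≤ᵇ-true : ∀ {m n} → ((m ≤ᵇ n) ≡ true) ⇔ (m ≤ n)
≤ᵇ-true {m} {n} = mk⇔ (≤ᵇ⇒≤ m n ∘ from T-≡) (to T-≡ ∘ ≤⇒≤ᵇ)

bool-ext : ∀ {a b} → (a ≡ true) ⇔ (b ≡ true) → a ≡ b
bool-ext {true}          e = sym (to e refl)
bool-ext {false} {true}  e = from e refl
bool-ext {false} {false} e = refl

exBelow-true : ∀ n {p} → (exBelow n p ≡ true) ⇔ (Σ ℕ λ x → x < n × p x ≡ true)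
exBelow-true zero    = mk⇔ (λ ()) (λ ())
exBelow-true (suc n) {p} = ∨-true ⇔∘ mk⇔
  [ (λ e → let x , x<n , px = to (exBelow-true n) e in x , m<n⇒m<1+n x<n , px)
  , (λ pn → n , ≤-refl , pn) ]
  back
  where
  back : (Σ ℕ λ x → x < suc n × p x ≡ true) → exBelow n p ≡ true ⊎ p n ≡ true
  back (x , x<1+n , px) with m≤n⇒m<n∨m≡n (≤-pred x<1+n)
  ... | inj₁ x<n  = inj₁ (from (exBelow-true n) (x , x<n , px))
  ... | inj₂ refl = inj₂ px

allBelow-true : ∀ n {p} → (allBelow n p ≡ true) ⇔ (∀ x → x < n → p x ≡ true)
allBelow-true zero    = mk⇔ (λ _ _ ()) (λ _ → refl)
allBelow-true (suc n) {p} = ∧-true ⇔∘ mk⇔ forth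
  (λ f → from (allBelow-true n) (λ x x<n → f x (m<n⇒m<1+n x<n)) , f n ≤-refl)
  where
  forth : allBelow n p ≡ true × p n ≡ true → ∀ x → x < suc n → p x ≡ true
  forth (f , pn) x x<1+n with m≤n⇒m<n∨m≡n (≤-pred x<1+n)
  ... | inj₁ x<n  = to (allBelow-true n) f x x<n
  ... | inj₂ refl = pn

allBelow-cong : ∀ n {p q} → (∀ x → x < n → p x ≡ q x) → allBelow n p ≡ allBelow n q
allBelow-cong zero    e = refl
allBelow-cong (suc n) e =
  cong₂ _∧_ (allBelow-cong n (λ x x<n → e x (m<n⇒m<1+n x<n))) (e n ≤-refl)

exBelow-cong : ∀ n {p q} → (∀ x → p x ≡ q x) → exBelow n p ≡ exBelow n q
exBelow-cong zero    e = refl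
exBelow-cong (suc n) e = cong₂ _∨_ (exBelow-cong n e) (e n)

-- First-order formulas

Ren : ℕ → ℕ → Set
Ren k l = Fin k → Fin l

lift : ∀ {k l} → Ren k l → Ren (suc k) (suc l)
lift σ zero    = zero
lift σ (suc i) = suc (σ i)

renT : ∀ {k l} → Ren k l → Term k → Term l
renT σ (var i) = var (σ i)
renT σ (lit n) = lit n
renT σ len     = len
renT σ (t ⊕ s) = renT σ t ⊕ renT σ s
renT σ (t ⊗ s) = renT σ t ⊗ renT σ s

renF : ∀ {k l} → Ren k l → Form k → Form l
renF σ (leq t s)  = leq (renT σ t) (renT σ s)
renF σ (bit t)    = bit (renT σ t)
renF σ (neg φ)    = neg (renF σ φ)
renF σ (and φ ψ)  = and (renF σ φ) (renF σ ψ)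
renF σ (or φ ψ)   = or (renF σ φ) (renF σ ψ)
renF σ (all< t φ) = all< (renT σ t) (renF (lift σ) φ)
renF σ (ex< t φ)  = ex< (renT σ t) (renF (lift σ) φ)

record Agrees {k l} (σ : Ren k l) (ρ : Vec ℕ k) (ρ′ : Vec ℕ l) : Set where
  constructor agrees
  field at : ∀ i → lookup ρ′ (σ i) ≡ lookup ρ i

lift-agrees : ∀ {k l} {σ : Ren k l} {ρ ρ′} x → Agrees σ ρ ρ′ → Agrees (lift σ) (x ∷ ρ) (x ∷ ρ′)
lift-agrees x (agrees a) = agrees λ { zero → refl ; (suc i) → a i }

module _ (X : List Bool) where

  evalT-ren : ∀ {k l} {σ : Ren k l} {ρ ρ′} → Agrees σ ρ ρ′ → ∀ t → evalT (renT σ t) ρ′ X ≡ evalT t ρ X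
  evalT-ren a (var i) = Agrees.at a i
  evalT-ren a (lit n) = refl
  evalT-ren a len     = refl
  evalT-ren a (t ⊕ s) = cong₂ _+_ (evalT-ren a t) (evalT-ren a s)
  evalT-ren a (t ⊗ s) = cong₂ _*_ (evalT-ren a t) (evalT-ren a s)

  evalF-ren : ∀ {k l} {σ : Ren k l} {ρ ρ′} → Agrees σ ρ ρ′ → ∀ φ → evalF (renF σ φ) ρ′ X ≡ evalF φ ρ X
  evalF-ren a (leq t s)  = cong₂ _≤ᵇ_ (evalT-ren a t) (evalT-ren a s)
  evalF-ren a (bit t)    = cong (bitAt X) (evalT-ren a t)
  evalF-ren a (neg φ)    = cong not (evalF-ren a φ)
  evalF-ren a (and φ ψ)  = cong₂ _∧_ (evalF-ren a φ) (evalF-ren a ψ)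
  evalF-ren a (or φ ψ)   = cong₂ _∨_ (evalF-ren a φ) (evalF-ren a ψ)
  evalF-ren {ρ = ρ} a (all< t φ) rewrite evalT-ren a t =
    allBelow-cong (evalT t ρ X) (λ x _ → evalF-ren (lift-agrees x a) φ)
  evalF-ren {ρ = ρ} a (ex< t φ) rewrite evalT-ren a t =
    exBelow-cong (evalT t ρ X) (λ x → evalF-ren (lift-agrees x a) φ)

wkT : ∀ {k} → Term k → Term (suc k)
wkT = renT suc

wkT-eval : ∀ {k} X x (ρ : Vec ℕ k) t → evalT (wkT t) (x ∷ ρ) X ≡ evalT t ρ X
wkT-eval X x ρ = evalT-ren X (agrees (λ _ → refl))

infix  6 _≐_ _≺_
infixr 5 _∧ᶠ_
infixr 4 _∨ᶠ_
infixr 3 _⇒ᶠ_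

-- A second syntax whose meaning is a proposition rather than a Boolean, so that definability is
-- argued with pairs, sums and functions. `compile` returns to `Form`, and `form` embeds formulas
-- that are only known abstractly.
data Fm (k : ℕ) : Set where
  _≐_ _≺_          : Term k → Term k → Fm k
  bitᶠ             : Term k → Fm k
  form             : Form k → Fm k
  ¬ᶠ_              : Fm k → Fm k
  _∧ᶠ_ _∨ᶠ_ _⇒ᶠ_   : Fm k → Fm k → Fm k
  ∀< ∃<            : Term k → Fm (suc k) → Fm k

⟦_⟧ : ∀ {k} → Fm k → Vec ℕ k → List Bool → Set
⟦ t ≐ s ⟧  ρ X = evalT t ρ X ≡ evalT s ρ X
⟦ t ≺ s ⟧  ρ X = evalT t ρ X < evalT s ρ X
⟦ bitᶠ t ⟧ ρ X = bitAt X (evalT t ρ X) ≡ true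
⟦ form φ ⟧ ρ X = evalF φ ρ X ≡ true
⟦ ¬ᶠ φ ⟧   ρ X = ¬ ⟦ φ ⟧ ρ X
⟦ φ ∧ᶠ ψ ⟧ ρ X = ⟦ φ ⟧ ρ X × ⟦ ψ ⟧ ρ X
⟦ φ ∨ᶠ ψ ⟧ ρ X = ⟦ φ ⟧ ρ X ⊎ ⟦ ψ ⟧ ρ X
⟦ φ ⇒ᶠ ψ ⟧ ρ X = ⟦ φ ⟧ ρ X → ⟦ ψ ⟧ ρ X
⟦ ∀< t φ ⟧ ρ X = ∀ x → x < evalT t ρ X → ⟦ φ ⟧ (x ∷ ρ) X
⟦ ∃< t φ ⟧ ρ X = Σ ℕ λ x → x < evalT t ρ X × ⟦ φ ⟧ (x ∷ ρ) X

compile : ∀ {k} → Fm k → Form k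
compile (t ≐ s)  = and (leq t s) (leq s t)
compile (t ≺ s)  = leq (lit 1 ⊕ t) s
compile (bitᶠ t) = bit t
compile (form φ) = φ
compile (¬ᶠ φ)   = neg (compile φ)
compile (φ ∧ᶠ ψ) = and (compile φ) (compile ψ)
compile (φ ∨ᶠ ψ) = or (compile φ) (compile ψ)
compile (φ ⇒ᶠ ψ) = or (neg (compile φ)) (compile ψ)
compile (∀< t φ) = all< t (compile φ)
compile (∃< t φ) = ex< t (compile φ)

compile-⟦⟧ : ∀ {k} (φ : Fm k) {ρ X} → (evalF (compile φ) ρ X ≡ true) ⇔ ⟦ φ ⟧ ρ X
compile-⟦⟧ (t ≐ s) = ∧-true ⇔∘ mk⇔
  (λ (p , q) → ≤-antisym (to ≤ᵇ-true p) (to ≤ᵇ-true q))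
  (λ e → from ≤ᵇ-true (≤-reflexive e) , from ≤ᵇ-true (≤-reflexive (sym e)))
compile-⟦⟧ (t ≺ s)  = ≤ᵇ-true
compile-⟦⟧ (bitᶠ t) = mk⇔ id id
compile-⟦⟧ (form φ) = mk⇔ id id
compile-⟦⟧ (¬ᶠ φ)   = not-true ⇔∘ mk⇔ (_∘ from (compile-⟦⟧ φ)) (_∘ to (compile-⟦⟧ φ))
compile-⟦⟧ (φ ∧ᶠ ψ) = ∧-true ⇔∘ mk⇔
  (λ (p , q) → to (compile-⟦⟧ φ) p , to (compile-⟦⟧ ψ) q)
  (λ (p , q) → from (compile-⟦⟧ φ) p , from (compile-⟦⟧ ψ) q)
compile-⟦⟧ (φ ∨ᶠ ψ) = ∨-true ⇔∘ mk⇔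
  (Sum.map (to (compile-⟦⟧ φ)) (to (compile-⟦⟧ ψ)))
  (Sum.map (from (compile-⟦⟧ φ)) (from (compile-⟦⟧ ψ)))
compile-⟦⟧ (φ ⇒ᶠ ψ) {ρ} {X} = ∨-true ⇔∘ mk⇔
  [ (λ ¬p p → ⊥-elim (to not-true ¬p (from (compile-⟦⟧ φ) p))) , (λ q _ → to (compile-⟦⟧ ψ) q) ]
  back
  where
  back : (⟦ φ ⟧ ρ X → ⟦ ψ ⟧ ρ X) → not (evalF (compile φ) ρ X) ≡ true ⊎ evalF (compile ψ) ρ X ≡ true
  back f with evalF (compile φ) ρ X in eq
  ... | true  = inj₂ (from (compile-⟦⟧ ψ) (f (to (compile-⟦⟧ φ) eq)))
  ... | false = inj₁ refl
compile-⟦⟧ (∀< t φ) = allBelow-true _ ⇔∘ mk⇔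
  (λ f x x<t → to (compile-⟦⟧ φ) (f x x<t)) (λ f x x<t → from (compile-⟦⟧ φ) (f x x<t))
compile-⟦⟧ (∃< t φ) = exBelow-true _ ⇔∘ mk⇔
  (λ (x , x<t , p) → x , x<t , to (compile-⟦⟧ φ) p) (λ (x , x<t , p) → x , x<t , from (compile-⟦⟧ φ) p)

-- Evaluation of the compiled formula decides it. This lets a reduction branch on whether its input
-- is well formed.
⟦_⟧? : ∀ {k} (φ : Fm k) ρ X → Dec (⟦ φ ⟧ ρ X)
⟦ φ ⟧? ρ X with evalF (compile φ) ρ X in eq
... | true  = yes (to (compile-⟦⟧ φ) eq)
... | false = no λ p → not-¬ (from (compile-⟦⟧ φ) p) eq

-- Bits of lists and monotone bounds on terms

bitAt-++ˡ : ∀ A B {p} → p < length A → bitAt (A ++ B) p ≡ bitAt A p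
bitAt-++ˡ (a ∷ A) B {zero}  _         = refl
bitAt-++ˡ (a ∷ A) B {suc p} (s≤s p<A) = bitAt-++ˡ A B p<A

bitAt-++ʳ : ∀ A B p → bitAt (A ++ B) (length A + p) ≡ bitAt B p
bitAt-++ʳ []      B p = refl
bitAt-++ʳ (a ∷ A) B p = bitAt-++ʳ A B p

bitAt-applyUpTo : ∀ f n {p} → p < n → bitAt (applyUpTo f n) p ≡ f p
bitAt-applyUpTo f (suc n) {zero}  _         = refl
bitAt-applyUpTo f (suc n) {suc p} (s≤s p<n) = bitAt-applyUpTo (f ∘ suc) n p<n

bitAt-beyond : ∀ X {p} → length X ≤ p → bitAt X p ≡ false
bitAt-beyond []      _         = refl
bitAt-beyond (x ∷ X) (s≤s X≤p) = bitAt-beyond X X≤p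

bits-ext : ∀ X Y → length X ≡ length Y → (∀ p → p < length Y → bitAt X p ≡ bitAt Y p) → X ≡ Y
bits-ext []      []      _ _ = refl
bits-ext (x ∷ X) (y ∷ Y) e b =
  cong₂ _∷_ (b 0 z<s) (bits-ext X Y (suc-injective e) (λ p p<Y → b (suc p) (s<s p<Y)))

-- Terms are monotone in their variables and in the length, so putting a common upper bound `B` for
-- all of these gives a closed bound. With `B` the bound of an inner function this is composition of
-- polynomials.
saturate : ∀ {k} → Term 0 → Term k → Term 0
saturate B (var i) = B
saturate B (lit n) = lit n
saturate B len     = B
saturate B (t ⊕ s) = saturate B t ⊕ saturate B s
saturate B (t ⊗ s) = saturate B t ⊗ saturate B s

saturate-bound : ∀ {k} B {X Y} {ρ : Vec ℕ k} → (∀ i → lookup ρ i ≤ evalT B [] X) →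
  length Y ≤ evalT B [] X → ∀ t → evalT t ρ Y ≤ evalT (saturate B t) [] X
saturate-bound B vs l (var i) = vs i
saturate-bound B vs l (lit n) = ≤-refl
saturate-bound B vs l len     = l
saturate-bound B vs l (t ⊕ s) = +-mono-≤ (saturate-bound B vs l t) (saturate-bound B vs l s)
saturate-bound B vs l (t ⊗ s) = *-mono-≤ (saturate-bound B vs l t) (saturate-bound B vs l s)

-- Composition of reductions

module Pullback (F : List Bool → List Bool) (F-ac0 : IsAC0 F) where

  private
    bound = proj₁ F-ac0
    lenφ  = proj₁ (proj₂ F-ac0)
    bitφ  = proj₁ (proj₂ (proj₂ F-ac0))
    bound-ok = proj₁ (proj₂ (proj₂ (proj₂ F-ac0)))
    len-ok   = proj₁ (proj₂ (proj₂ (proj₂ (proj₂ F-ac0))))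
    bit-ok   = proj₂ (proj₂ (proj₂ (proj₂ (proj₂ F-ac0))))

  at0 : ∀ {l} → Form 1 → Form (suc l)
  at0 = renF (λ _ → zero)

  at0-eval : ∀ {l} φ x (ρ : Vec ℕ l) X → evalF (at0 φ) (x ∷ ρ) X ≡ evalF φ (x ∷ []) X
  at0-eval φ x ρ X = evalF-ren X (agrees λ { zero → refl }) φ

  at0-len : ∀ {l} x (ρ : Vec ℕ l) X → (x < length (F X)) ⇔ (evalF (at0 lenφ) (x ∷ ρ) X ≡ true)
  at0-len x ρ X rewrite at0-eval lenφ x ρ X = len-ok X x

  bitAt-F : ∀ X p → (bitAt (F X) p ≡ true) ⇔ (evalF lenφ (p ∷ []) X ≡ true × evalF bitφ (p ∷ []) X ≡ true)
  bitAt-F X p = mk⇔ forth λ (l , b) → trans (bit-ok X p (from (len-ok X p) l)) b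
    where
    forth : bitAt (F X) p ≡ true → evalF lenφ (p ∷ []) X ≡ true × evalF bitφ (p ∷ []) X ≡ true
    forth b with p <? length (F X)
    ... | yes p<F = to (len-ok X p) p<F , trans (sym (bit-ok X p p<F)) b
    ... | no  p≮F = ⊥-elim (not-¬ b (bitAt-beyond (F X) (≮⇒≥ p≮F)))

  -- The variable ℓ stands for the length of the intermediate string F X.
  pullT : ∀ {k l} → Ren k l → Fin l → Term k → Term l
  pullT σ ℓ (var i) = var (σ i)
  pullT σ ℓ (lit n) = lit n
  pullT σ ℓ len     = var ℓ
  pullT σ ℓ (t ⊕ s) = pullT σ ℓ t ⊕ pullT σ ℓ s
  pullT σ ℓ (t ⊗ s) = pullT σ ℓ t ⊗ pullT σ ℓ s

  -- The formulas describing `F` speak about a variable, so one is bound to the value of `t`. The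
  -- conjunct `lenφ` is essential: past the end of `F X` the formula `bitφ` is unconstrained, while
  -- `bitAt` is false there.
  bitOfF : ∀ {k} → Term k → Fm k
  bitOfF t = ∃< (lit 1 ⊕ t) (var zero ≐ wkT t ∧ᶠ form (at0 lenφ) ∧ᶠ form (at0 bitφ))

  pullF : ∀ {k l} → Ren k l → Fin l → Form k → Form l
  pullF σ ℓ (leq t s)  = leq (pullT σ ℓ t) (pullT σ ℓ s)
  pullF σ ℓ (bit t)    = compile (bitOfF (pullT σ ℓ t))
  pullF σ ℓ (neg φ)    = neg (pullF σ ℓ φ)
  pullF σ ℓ (and φ ψ)  = and (pullF σ ℓ φ) (pullF σ ℓ ψ)
  pullF σ ℓ (or φ ψ)   = or (pullF σ ℓ φ) (pullF σ ℓ ψ)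
  pullF σ ℓ (all< t φ) = all< (pullT σ ℓ t) (pullF (lift σ) (suc ℓ) φ)
  pullF σ ℓ (ex< t φ)  = ex< (pullT σ ℓ t) (pullF (lift σ) (suc ℓ) φ)

  module _ (X : List Bool) where

    pullT-eval : ∀ {k l} {σ : Ren k l} {ℓ ρ ρ′} → Agrees σ ρ ρ′ → lookup ρ′ ℓ ≡ length (F X) →
      ∀ t → evalT (pullT σ ℓ t) ρ′ X ≡ evalT t ρ (F X)
    pullT-eval a e (var i) = Agrees.at a i
    pullT-eval a e (lit n) = refl
    pullT-eval a e len     = e
    pullT-eval a e (t ⊕ s) = cong₂ _+_ (pullT-eval a e t) (pullT-eval a e s)
    pullT-eval a e (t ⊗ s) = cong₂ _*_ (pullT-eval a e t) (pullT-eval a e s)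

    bitOfF-eval : ∀ {k} (t : Term k) ρ → evalF (compile (bitOfF t)) ρ X ≡ bitAt (F X) (evalT t ρ X)
    bitOfF-eval t ρ = bool-ext (compile-⟦⟧ (bitOfF t) ⇔∘ (mk⇔ forth back ⇔∘ ⇔-sym (bitAt-F X _)))
      where
      forth : ⟦ bitOfF t ⟧ ρ X → _
      forth (x , _ , e , l , b) with refl ← trans e (wkT-eval X x ρ t) =
        trans (sym (at0-eval lenφ x ρ X)) l , trans (sym (at0-eval bitφ x ρ X)) b
      back : _ → ⟦ bitOfF t ⟧ ρ X
      back (l , b) = evalT t ρ X , ≤-refl , sym (wkT-eval X _ ρ t)
        , trans (at0-eval lenφ _ ρ X) l , trans (at0-eval bitφ _ ρ X) b

    pullF-eval : ∀ {k l} {σ : Ren k l} {ℓ ρ ρ′} → Agrees σ ρ ρ′ → lookup ρ′ ℓ ≡ length (F X) →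
      ∀ φ → evalF (pullF σ ℓ φ) ρ′ X ≡ evalF φ ρ (F X)
    pullF-eval a e (leq t s)  = cong₂ _≤ᵇ_ (pullT-eval a e t) (pullT-eval a e s)
    pullF-eval {σ = σ} {ℓ} {ρ′ = ρ′} a e (bit t) =
      trans (bitOfF-eval (pullT σ ℓ t) ρ′) (cong (bitAt (F X)) (pullT-eval a e t))
    pullF-eval a e (neg φ)    = cong not (pullF-eval a e φ)
    pullF-eval a e (and φ ψ)  = cong₂ _∧_ (pullF-eval a e φ) (pullF-eval a e ψ)
    pullF-eval a e (or φ ψ)   = cong₂ _∨_ (pullF-eval a e φ) (pullF-eval a e ψ)
    pullF-eval {ℓ = ℓ} {ρ = ρ} a e (all< t φ) rewrite pullT-eval {ℓ = ℓ} a e t =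
      allBelow-cong (evalT t ρ (F X)) (λ x _ → pullF-eval (lift-agrees x a) e φ)
    pullF-eval {ℓ = ℓ} {ρ = ρ} a e (ex< t φ) rewrite pullT-eval {ℓ = ℓ} a e t =
      exBelow-cong (evalT t ρ (F X)) (λ x → pullF-eval (lift-agrees x a) e φ)

  -- The length of `F X` is the only ℓ such that `lenφ` holds everywhere below ℓ and fails at ℓ. It
  -- may equal the bound, hence the search range of one more than `bound`.
  pullback : Form 1 → Fm 1
  pullback φ = ∃< (lit 1 ⊕ renT (λ ()) bound)
    (∀< (var zero) (form (at0 lenφ)) ∧ᶠ ¬ᶠ form (at0 lenφ) ∧ᶠ form (pullF (λ _ → suc zero) zero φ))

  pullback-eval : ∀ φ i X → evalF (compile (pullback φ)) (i ∷ []) X ≡ evalF φ (i ∷ []) (F X)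
  pullback-eval φ i X = bool-ext (compile-⟦⟧ (pullback φ) ⇔∘ mk⇔ forth back)
    where
    pulled : ∀ ℓ → ℓ ≡ length (F X) →
      evalF (pullF (λ _ → suc zero) zero φ) (ℓ ∷ i ∷ []) X ≡ evalF φ (i ∷ []) (F X)
    pulled ℓ e = pullF-eval X (agrees λ { zero → refl }) e φ
    forth : ⟦ pullback φ ⟧ (i ∷ []) X → evalF φ (i ∷ []) (F X) ≡ true
    forth (ℓ , _ , below , notAt , p) = trans (sym (pulled ℓ (≤-antisym ℓ≤F F≤ℓ))) p
      where
      F≤ℓ : length (F X) ≤ ℓ
      F≤ℓ = ≮⇒≥ (λ ℓ<F → notAt (to (at0-len ℓ _ X) ℓ<F))
      ℓ≤F : ℓ ≤ length (F X)
      ℓ≤F = ≮⇒≥ (λ F<ℓ → <-irrefl refl (from (at0-len _ _ X) (below _ F<ℓ)))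
    back : evalF φ (i ∷ []) (F X) ≡ true → ⟦ pullback φ ⟧ (i ∷ []) X
    back p = length (F X)
      , s≤s (subst (_ ≤_) (sym (evalT-ren X (agrees λ ()) bound)) (bound-ok X))
      , (λ x x<F → to (at0-len x _ X) x<F)
      , (λ q → <-irrefl refl (from (at0-len _ _ X) q))
      , trans (pulled _ refl) p

  pullback-IsAC0 : ∀ G → IsAC0 G → IsAC0 (G ∘ F)
  pullback-IsAC0 G (boundG , lenG , bitG , boundG-ok , lenG-ok , bitG-ok) =
    saturate bound boundG , compile (pullback lenG) , compile (pullback bitG)
    , (λ X → ≤-trans (boundG-ok (F X)) (saturate-bound bound (λ ()) (bound-ok X) boundG))
    , (λ X i → subst (λ b → _ ⇔ (b ≡ true)) (sym (pullback-eval lenG i X)) (lenG-ok (F X) i))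
    , (λ X i i<GF → trans (bitG-ok (F X) i i<GF) (sym (pullback-eval bitG i X)))

≤AC0-trans : ∀ {A B C} → A ≤AC0 B → B ≤AC0 C → A ≤AC0 C
≤AC0-trans (F , F-ac0 , F-ok) (G , G-ac0 , G-ok) =
  G ∘ F , Pullback.pullback-IsAC0 F F-ac0 G G-ac0 , λ X → F-ok X ⇔∘ G-ok (F X)

-- Row-major positions in concatenated blocks

split-position : ∀ n l p → p < n * l → Σ ℕ λ x → x < n × Σ ℕ λ q → q < l × p ≡ x * l + q
split-position (suc n) l p p<nl with p <? l
... | yes p<l = 0 , z<s , p , p<l , refl
... | no  p≮l with split-position n l (p ∸ l) (+-cancelˡ-< l _ _ (subst (_< l + n * l) (sym (m+[n∸m]≡n (≮⇒≥ p≮l))) p<nl))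
...   | x , x<n , q , q<l , e = suc x , s<s x<n , q , q<l ,
        trans (sym (m+[n∸m]≡n (≮⇒≥ p≮l))) (trans (cong (l +_) e) (sym (+-assoc l (x * l) q)))

position-unique : ∀ l x x′ {q q′} → q < l → q′ < l → x * l + q ≡ x′ * l + q′ → x ≡ x′ × q ≡ q′
position-unique l zero    zero     q<l q′<l e = refl , e
position-unique l zero    (suc x′) {q} {q′} q<l q′<l e =
  ⊥-elim (<⇒≱ q<l (subst (l ≤_) (trans (sym (+-assoc l (x′ * l) q′)) (sym e)) (m≤m+n l _)))
position-unique l (suc x) zero     {q} {q′} q<l q′<l e =
  ⊥-elim (<⇒≱ q′<l (subst (l ≤_) (trans (sym (+-assoc l (x * l) q)) e) (m≤m+n l _)))
position-unique l (suc x) (suc x′) {q} {q′} q<l q′<l e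
  with refl , refl ← position-unique l x x′ q<l q′<l (+-cancelˡ-≡ l _ _
         (trans (sym (+-assoc l (x * l) q)) (trans e (+-assoc l (x′ * l) q′)))) = refl , refl

position-bound : ∀ {n l x q} → x < n → q < l → x * l + q < n * l
position-bound {n} {l} {x} {q} x<n q<l = begin-strict
  x * l + q  <⟨ +-monoʳ-< (x * l) q<l ⟩
  x * l + l  ≡⟨ +-comm (x * l) l ⟩
  suc x * l  ≤⟨ *-monoˡ-≤ l x<n ⟩
  n * l      ∎
  where open ≤-Reasoning

concat-length : ∀ n l (f : ℕ → List Bool) → (∀ x → x < n → length (f x) ≡ l) →
  length (concat (applyUpTo f n)) ≡ n * l
concat-length zero    l f e = refl
concat-length (suc n) l f e = trans (length-++ (f 0))
  (cong₂ _+_ (e 0 z<s) (concat-length n l (f ∘ suc) (λ x x<n → e (suc x) (s<s x<n))))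

concat-bit : ∀ n l (f : ℕ → List Bool) → (∀ x → x < n → length (f x) ≡ l) →
  ∀ {x q} → x < n → q < l → bitAt (concat (applyUpTo f n)) (x * l + q) ≡ bitAt (f x) q
concat-bit (suc n) l f e {zero}  x<n       q<l = bitAt-++ˡ (f 0) _ (subst (_ <_) (sym (e 0 z<s)) q<l)
concat-bit (suc n) l f e {suc x} {q} (s≤s x<n) q<l with refl ← e 0 z<s =
  trans (cong (bitAt (f 0 ++ rest)) (+-assoc l (x * l) q))
    (trans (bitAt-++ʳ (f 0) rest (x * l + q)) (concat-bit n l (f ∘ suc) (λ y y<n → e (suc y) (s<s y<n)) x<n q<l))
  where rest = concat (applyUpTo (f ∘ suc) n)

-- Definable lists

-- The form in which outputs are assembled. The length is a term rather than a formula, so the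
-- offsets inside a concatenation are again terms.
record DefList (k : ℕ) : Set where
  field
    lenT        : Term k
    bitF        : Form (suc k)
    list        : Vec ℕ k → List Bool → List Bool
    length-list : ∀ ρ X → length (list ρ X) ≡ evalT lenT ρ X
    bit-list    : ∀ ρ X p → p < evalT lenT ρ X → bitAt (list ρ X) p ≡ evalF bitF (p ∷ ρ) X

open DefList

tabᴸ : ∀ {k} → Term k → Fm (suc k) → DefList k
tabᴸ t φ = record
  { lenT        = t
  ; bitF        = compile φ
  ; list        = λ ρ X → applyUpTo (λ p → evalF (compile φ) (p ∷ ρ) X) (evalT t ρ X)
  ; length-list = λ ρ X → length-applyUpTo _ _
  ; bit-list    = λ ρ X p → bitAt-applyUpTo _ _
  }

infixr 5 _++ᴸ_
_++ᴸ_ : ∀ {k} → DefList k → DefList k → DefList k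
_++ᴸ_ {k} A B = record
  { lenT        = lenT A ⊕ lenT B
  ; bitF        = compile φ
  ; list        = λ ρ X → list A ρ X ++ list B ρ X
  ; length-list = λ ρ X → trans (length-++ (list A ρ X)) (cong₂ _+_ (length-list A ρ X) (length-list B ρ X))
  ; bit-list    = λ ρ X p p<AB → bool-ext (mk⇔ (forth ρ X p p<AB) (back ρ X p p<AB) ⇔∘ ⇔-sym (compile-⟦⟧ φ))
  }
  where
  φ : Fm (suc k)
  φ = var zero ≺ wkT (lenT A) ∧ᶠ form (bitF A)
    -- Terms have no subtraction, so the offset q into the second list is searched for with p =
    -- length + q; q ≤ p explains the bound.
    ∨ᶠ ∃< (lit 1 ⊕ var zero) (var (suc zero) ≐ wkT (wkT (lenT A)) ⊕ var zero ∧ᶠ form (renF (lift suc) (bitF B)))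
  wk² : ∀ ρ X q p → evalT (wkT (wkT (lenT A))) (q ∷ p ∷ ρ) X ≡ evalT (lenT A) ρ X
  wk² ρ X q p = trans (wkT-eval X q (p ∷ ρ) (wkT (lenT A))) (wkT-eval X p ρ (lenT A))
  bitB : ∀ ρ X q p → evalF (renF (lift suc) (bitF B)) (q ∷ p ∷ ρ) X ≡ evalF (bitF B) (q ∷ ρ) X
  bitB ρ X q p = evalF-ren X (lift-agrees q (agrees λ _ → refl)) (bitF B)
  left : ∀ ρ X p → p < evalT (lenT A) ρ X → bitAt (list A ρ X ++ list B ρ X) p ≡ evalF (bitF A) (p ∷ ρ) X
  left ρ X p p<A = trans (bitAt-++ˡ (list A ρ X) _ (subst (p <_) (sym (length-list A ρ X)) p<A)) (bit-list A ρ X p p<A)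
  right : ∀ ρ X q → q < evalT (lenT B) ρ X →
    bitAt (list A ρ X ++ list B ρ X) (evalT (lenT A) ρ X + q) ≡ evalF (bitF B) (q ∷ ρ) X
  right ρ X q q<B = trans (cong (λ a → bitAt (list A ρ X ++ list B ρ X) (a + q)) (sym (length-list A ρ X)))
    (trans (bitAt-++ʳ (list A ρ X) _ q) (bit-list B ρ X q q<B))
  forth : ∀ ρ X p → p < evalT (lenT A) ρ X + evalT (lenT B) ρ X →
    bitAt (list A ρ X ++ list B ρ X) p ≡ true → ⟦ φ ⟧ (p ∷ ρ) X
  forth ρ X p p<AB b with p <? evalT (lenT A) ρ X
  ... | yes p<A = inj₁ (subst (p <_) (sym (wkT-eval X p ρ (lenT A))) p<A , trans (sym (left ρ X p p<A)) b)
  ... | no  p≮A with q , refl ← m≤n⇒∃[o]m+o≡n (≮⇒≥ p≮A) = inj₂ (q , s≤s (m≤n+m q _)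
      , cong (_+ q) (sym (wk² ρ X q _))
      , trans (bitB ρ X q _) (trans (sym (right ρ X q (+-cancelˡ-< (evalT (lenT A) ρ X) _ _ p<AB))) b))
  back : ∀ ρ X p → p < evalT (lenT A) ρ X + evalT (lenT B) ρ X →
    ⟦ φ ⟧ (p ∷ ρ) X → bitAt (list A ρ X ++ list B ρ X) p ≡ true
  back ρ X p p<AB (inj₁ (p<A , b)) = trans (left ρ X p (subst (p <_) (wkT-eval X p ρ (lenT A)) p<A)) b
  back ρ X p p<AB (inj₂ (q , _ , e , b)) with refl ← trans e (cong (_+ q) (wk² ρ X q p)) =
    trans (right ρ X q (+-cancelˡ-< (evalT (lenT A) ρ X) _ _ p<AB)) (trans (sym (bitB ρ X q p)) b)

-- The hypothesis `uniform` makes this definable: the block number and the offset of a position are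
-- a quotient and a remainder by `l`, found by bounded search. Blocks of varying length would
-- require summing their lengths.
blocksᴸ : ∀ {k} (t l : Term k) (L : DefList (suc k)) → (∀ x ρ X → evalT (lenT L) (x ∷ ρ) X ≡ evalT l ρ X) → DefList k
blocksᴸ {k} t l L uniform = record
  { lenT        = t ⊗ l
  ; bitF        = compile φ
  ; list        = out
  ; length-list = λ ρ X → concat-length (evalT t ρ X) _ (λ x → list L (x ∷ ρ) X) (λ x _ → len-L ρ X x)
  ; bit-list    = bits
  }
  where
  out : Vec ℕ k → List Bool → List Bool
  out ρ X = concat (applyUpTo (λ x → list L (x ∷ ρ) X) (evalT t ρ X))
  φ : Fm (suc k)
  φ = ∃< (wkT t) (∃< (wkT (wkT l))
        (var (suc (suc zero)) ≐ (var (suc zero) ⊗ wkT (wkT (wkT l))) ⊕ var zero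
         ∧ᶠ form (renF (lift (lift suc)) (bitF L))))
  len-L : ∀ ρ X x → length (list L (x ∷ ρ) X) ≡ evalT l ρ X
  len-L ρ X x = trans (length-list L (x ∷ ρ) X) (uniform x ρ X)
  wk² : ∀ ρ X q p → evalT (wkT (wkT l)) (q ∷ p ∷ ρ) X ≡ evalT l ρ X
  wk² ρ X q p = trans (wkT-eval X q (p ∷ ρ) (wkT l)) (wkT-eval X p ρ l)
  wk³ : ∀ ρ X q x p → evalT (wkT (wkT (wkT l))) (q ∷ x ∷ p ∷ ρ) X ≡ evalT l ρ X
  wk³ ρ X q x p = trans (wkT-eval X q (x ∷ p ∷ ρ) (wkT (wkT l))) (wk² ρ X x p)
  bitL : ∀ ρ X q x p → evalF (renF (lift (lift suc)) (bitF L)) (q ∷ x ∷ p ∷ ρ) X ≡ evalF (bitF L) (q ∷ x ∷ ρ) X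
  bitL ρ X q x p = evalF-ren X (lift-agrees q (lift-agrees x (agrees λ _ → refl))) (bitF L)
  block : ∀ ρ X {x q} → x < evalT t ρ X → q < evalT l ρ X →
    bitAt (out ρ X) (x * evalT l ρ X + q) ≡ evalF (bitF L) (q ∷ x ∷ ρ) X
  block ρ X {x} {q} x<t q<l = trans (concat-bit _ _ _ (λ x _ → len-L ρ X x) x<t q<l)
    (bit-list L (x ∷ ρ) X q (subst (q <_) (sym (uniform x ρ X)) q<l))
  bits : ∀ ρ X p → p < evalT t ρ X * evalT l ρ X → bitAt (out ρ X) p ≡ evalF (compile φ) (p ∷ ρ) X
  bits ρ X p p<tl with split-position (evalT t ρ X) (evalT l ρ X) p p<tl
  ... | x , x<t , q , q<l , refl = trans (block ρ X x<t q<l) (bool-ext (mk⇔ forth back ⇔∘ ⇔-sym (compile-⟦⟧ φ)))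
    where
    forth : evalF (bitF L) (q ∷ x ∷ ρ) X ≡ true → ⟦ φ ⟧ (x * evalT l ρ X + q ∷ ρ) X
    forth b = x , subst (x <_) (sym (wkT-eval X _ ρ t)) x<t
      , q , subst (q <_) (sym (wk² ρ X x _)) q<l
      , cong (λ l → x * l + q) (sym (wk³ ρ X q x _))
      , trans (bitL ρ X q x _) b
    back : ⟦ φ ⟧ (x * evalT l ρ X + q ∷ ρ) X → evalF (bitF L) (q ∷ x ∷ ρ) X ≡ true
    back (x′ , _ , q′ , q′<l , e , b)
      with refl , refl ← position-unique (evalT l ρ X) x x′ q<l (subst (q′ <_) (wk² ρ X x′ _) q′<l)
             (trans e (cong (λ l → x′ * l + q′) (wk³ ρ X q′ x′ _))) = trans (sym (bitL ρ X q x _)) b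

-- Reductions from a definable shape of the input

module Reduction
  {A B : Problem} (shape : Fm 3) (L : DefList 3)
  (bounded  : ∀ X ρ → ⟦ shape ⟧ ρ X → ∀ i → lookup ρ i < length X)
  (unique   : ∀ X ρ ρ′ → ⟦ shape ⟧ ρ X → ⟦ shape ⟧ ρ′ X → ρ ≡ ρ′)
  (A-shape  : ∀ X → A X → ∃ λ ρ → ⟦ shape ⟧ ρ X)
  (¬B-empty : ¬ B [])
  (correct  : ∀ X ρ → ⟦ shape ⟧ ρ X → A X ⇔ B (list L ρ X))
  where

  params : ∀ {j} → Ren 3 (3 + j)
  params zero             = zero
  params (suc zero)       = suc zero
  params (suc (suc zero)) = suc (suc zero)

  params-agree : ∀ {j a b c} {η : Vec ℕ j} → Agrees params (a ∷ b ∷ c ∷ []) (a ∷ b ∷ c ∷ η)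
  params-agree = agrees λ { zero → refl ; (suc zero) → refl ; (suc (suc zero)) → refl }

  -- `bitF L` expects the output index before the parameters, but the quantifiers of `withParams`
  -- push the parameters in front of the index.
  index-params : Ren 4 4
  index-params zero    = suc (suc (suc zero))
  index-params (suc i) = params i

  index-params-agree : ∀ {a b c i} → Agrees index-params (i ∷ a ∷ b ∷ c ∷ []) (a ∷ b ∷ c ∷ i ∷ [])
  index-params-agree = agrees λ { zero → refl ; (suc i) → Agrees.at params-agree i }

  -- Since the parameters are determined by the string and smaller than its length, asserting `φ` of
  -- some parameters amounts to asserting it of the parameters. Nothing has to be computed.
  withParams : ∀ {j} → Fm (3 + j) → Fm j
  withParams φ = ∃< len (∃< len (∃< len (form (renF params (compile shape)) ∧ᶠ φ)))

  shape-ren : ∀ {j a b c X} {η : Vec ℕ j} →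
    (evalF (renF params (compile shape)) (a ∷ b ∷ c ∷ η) X ≡ true) ⇔ ⟦ shape ⟧ (a ∷ b ∷ c ∷ []) X
  shape-ren {X = X} = mk⇔ (trans (sym e)) (trans e) ⇔∘ compile-⟦⟧ shape
    where e = evalF-ren X params-agree (compile shape)

  withParams-⟦⟧ : ∀ {j} (φ : Fm (3 + j)) {η : Vec ℕ j} {X a b c} → ⟦ shape ⟧ (a ∷ b ∷ c ∷ []) X →
    ⟦ withParams φ ⟧ η X ⇔ ⟦ φ ⟧ (a ∷ b ∷ c ∷ η) X
  withParams-⟦⟧ φ {η} {X} {a} {b} {c} sh = mk⇔ forth back
    where
    forth : ⟦ withParams φ ⟧ η X → ⟦ φ ⟧ (a ∷ b ∷ c ∷ η) X
    forth (c′ , _ , b′ , _ , a′ , _ , s , p) with refl ← unique X _ _ sh (to shape-ren s) = p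
    back : ⟦ φ ⟧ (a ∷ b ∷ c ∷ η) X → ⟦ withParams φ ⟧ η X
    back p = c , bounded X _ sh (suc (suc zero)) , b , bounded X _ sh (suc zero) , a , bounded X _ sh zero
      , from shape-ren sh , p

  withParams-shaped : ∀ {j} (φ : Fm (3 + j)) {η : Vec ℕ j} {X} → ⟦ withParams φ ⟧ η X → ∃ λ ρ → ⟦ shape ⟧ ρ X
  withParams-shaped φ (c , _ , b , _ , a , _ , s , _) = a ∷ b ∷ c ∷ [] , to shape-ren s

  shaped? : ∀ X → Dec (∃ λ ρ → ⟦ shape ⟧ ρ X)
  shaped? X with ⟦ withParams (lit 0 ≐ lit 0) ⟧? [] X
  ... | yes s = yes (withParams-shaped (lit 0 ≐ lit 0) s)
  ... | no ¬s = no λ { (a ∷ b ∷ c ∷ [] , sh) → ¬s (from (withParams-⟦⟧ (lit 0 ≐ lit 0) sh) refl) }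

  -- Strings without the shape are not in `A`, and their image, the empty string, is not in `B`. The
  -- formulas for the output are false on such strings because they begin by asserting the shape.
  F : List Bool → List Bool
  F X with shaped? X
  ... | yes (ρ , _) = list L ρ X
  ... | no _        = []

  F-correct : ∀ X → A X ⇔ B (F X)
  F-correct X with shaped? X
  ... | yes (ρ , sh) = correct X ρ sh
  ... | no ¬sh       = mk⇔ (⊥-elim ∘ ¬sh ∘ A-shape X) (⊥-elim ∘ ¬B-empty)

  inRange bitThere : Fm 4
  inRange  = var (suc (suc (suc zero))) ≺ renT params (lenT L)
  bitThere = form (renF index-params (bitF L))

  length-F : ∀ X i → (i < length (F X)) ⇔ ⟦ withParams inRange ⟧ (i ∷ []) X
  length-F X i with shaped? X
  ... | yes (ρ@(a ∷ b ∷ c ∷ []) , sh) =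
          mk⇔ (subst (i <_) e) (subst (i <_) (sym e)) ⇔∘ ⇔-sym (withParams-⟦⟧ inRange sh)
    where e = trans (length-list L ρ X) (sym (evalT-ren X (params-agree {η = i ∷ []}) (lenT L)))
  ... | no ¬sh = mk⇔ (λ ()) (⊥-elim ∘ ¬sh ∘ withParams-shaped inRange)

  bitAt-F : ∀ X i → i < length (F X) → bitAt (F X) i ≡ evalF (compile (withParams bitThere)) (i ∷ []) X
  bitAt-F X i i<F with shaped? X
  ... | yes (ρ@(a ∷ b ∷ c ∷ []) , sh) = bool-ext (mk⇔ (trans (sym e)) (trans e)
          ⇔∘ (⇔-sym (withParams-⟦⟧ bitThere sh) ⇔∘ ⇔-sym (compile-⟦⟧ (withParams bitThere))))
    where
    e = trans (bit-list L ρ X i (subst (i <_) (length-list L ρ X) i<F))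
          (sym (evalF-ren X index-params-agree (bitF L)))

  F-bound : ∀ X → length (F X) ≤ evalT (saturate len (lenT L)) [] X
  F-bound X with shaped? X
  ... | yes (ρ , sh) = subst (_≤ evalT (saturate len (lenT L)) [] X) (sym (length-list L ρ X))
          (saturate-bound len (λ i → <⇒≤ (bounded X ρ sh i)) ≤-refl (lenT L))
  ... | no _ = z≤n

  reduction : A ≤AC0 B
  reduction = F
    , ( saturate len (lenT L) , compile (withParams inRange) , compile (withParams bitThere)
      , F-bound , (λ X i → length-F X i ⇔∘ ⇔-sym (compile-⟦⟧ (withParams inRange))) , bitAt-F )
    , F-correct

-- Segments of a bit string

record At (X : List Bool) (k : ℕ) (L : List Bool) : Set where
  constructor mkAt
  field bits : ∀ p → p < length L → bitAt X (k + p) ≡ bitAt L p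

open At

At-self : ∀ X → At X 0 X
At-self X = mkAt λ _ _ → refl

At-≡ : ∀ {X} L → length X ≡ length L → At X 0 L → X ≡ L
At-≡ L e a = bits-ext _ L e (bits a)

-- Both directions are used: one parses an encoding into its fields, the other recognises a string
-- with the right fields as an encoding.
At-++ : ∀ {X k a} A {B} → length A ≡ a → At X k (A ++ B) ⇔ (At X k A × At X (k + a) B)
At-++ {X} {k} A {B} refl = mk⇔ (λ ab → left ab , right ab) both
  where
  left : At X k (A ++ B) → At X k A
  left ab = mkAt λ p p<A → trans (bits ab p (subst (p <_) (sym (length-++ A)) (m≤n⇒m≤n+o _ p<A))) (bitAt-++ˡ A B p<A)
  right : At X k (A ++ B) → At X (k + length A) B
  right ab = mkAt λ p p<B → trans (cong (bitAt X) (+-assoc k (length A) p))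
    (trans (bits ab (length A + p) (subst (length A + p <_) (sym (length-++ A)) (+-monoʳ-< (length A) p<B))) (bitAt-++ʳ A B p))
  both : At X k A × At X (k + length A) B → At X k (A ++ B)
  both (a , b) = mkAt segment
    where
    segment : ∀ p → p < length (A ++ B) → bitAt X (k + p) ≡ bitAt (A ++ B) p
    segment p p<AB with p <? length A
    ... | yes p<A = trans (bits a p p<A) (sym (bitAt-++ˡ A B p<A))
    ... | no  p≮A with q , refl ← m≤n⇒∃[o]m+o≡n (≮⇒≥ p≮A) =
      trans (cong (bitAt X) (sym (+-assoc k (length A) q)))
        (trans (bits b q (+-cancelˡ-< (length A) _ _ (subst (_ <_) (length-++ A) p<AB))) (sym (bitAt-++ʳ A B q)))

At-applyUpTo : ∀ {X k f} n → At X k (applyUpTo f n) → ∀ p → p < n → bitAt X (k + p) ≡ f p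
At-applyUpTo {f = f} n a p p<n = trans (bits a p (subst (p <_) (sym (length-applyUpTo f n)) p<n)) (bitAt-applyUpTo f n p<n)

At-concat : ∀ {X k l f} n → (∀ x → length (f x) ≡ l) → At X k (concat (applyUpTo f n)) →
  ∀ x → x < n → At X (k + x * l) (f x)
At-concat {X} {k} {l} {f} n e a x x<n = mkAt λ q q<fx → let q<l = subst (q <_) (e x) q<fx in
  trans (cong (bitAt X) (+-assoc k (x * l) q))
    (trans (bits a (x * l + q) (subst (_ <_) (sym (concat-length n l f (λ x _ → e x))) (position-bound x<n q<l)))
      (concat-bit n l f (λ x _ → e x) x<n q<l))

Ones : List Bool → ℕ → ℕ → Set
Ones X k n = ∀ x → x < n → bitAt X (k + x) ≡ true

OneHot : List Bool → ℕ → ℕ → ℕ → Set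
OneHot X k n d = ∀ x → x < n → (bitAt X (k + x) ≡ true → x ≡ d) × (x ≡ d → bitAt X (k + x) ≡ true)

OneHot-unique : ∀ {X k n d d′} → d < n → OneHot X k n d → OneHot X k n d′ → d ≡ d′
OneHot-unique {d = d} d<n h h′ = proj₁ (h′ d d<n) (proj₂ (h d d<n) refl)

-- A unary numeral with its terminating zero: if two readings differed, the terminator of the
-- shorter would lie inside the longer.
Ones-unique : ∀ {X k m m′} → Ones X k m → ¬ bitAt X (k + m) ≡ true → Ones X k m′ → ¬ bitAt X (k + m′) ≡ true → m ≡ m′
Ones-unique {m = m} {m′} o z o′ z′ with <-cmp m m′
... | tri< m<m′ _ _ = ⊥-elim (z (o′ m m<m′))
... | tri≈ _ e _    = e
... | tri> _ _ m′<m = ⊥-elim (z′ (o m′ m′<m))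

At-ones : ∀ {X k} n → At X k (L.replicate n true) ⇔ Ones X k n
At-ones n = mk⇔
  (λ a x x<n → trans (bits a x (subst (x <_) (sym (length-replicate n)) x<n)) (bit-true n x x<n))
  (λ o → mkAt λ x x<n → let x<n′ = subst (x <_) (length-replicate n) x<n in trans (o x x<n′) (sym (bit-true n x x<n′)))
  where
  bit-true : ∀ n x → x < n → bitAt (L.replicate n true) x ≡ true
  bit-true (suc n) zero    _         = refl
  bit-true (suc n) (suc x) (s≤s x<n) = bit-true n x x<n

At-zero : ∀ {X k} → At X k (false ∷ []) ⇔ (¬ bitAt X k ≡ true)
At-zero {X} {k} = mk⇔
  (λ a → not-¬ (trans (cong (bitAt X) (sym (+-identityʳ k))) (bits a 0 z<s)))
  (λ z → mkAt λ { zero _ → trans (cong (bitAt X) (+-identityʳ k)) (¬-not z) ; (suc p) (s≤s ()) })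

bitAt-toList : ∀ {n} (v : Vec Bool n) i → bitAt (toList v) (toℕ i) ≡ lookup v i
bitAt-toList (x ∷ v) zero    = refl
bitAt-toList (x ∷ v) (suc i) = bitAt-toList v i

At-toList : ∀ {X k n} (v : Vec Bool n) → At X k (toList v) ⇔ (∀ i → bitAt X (k + toℕ i) ≡ lookup v i)
At-toList {X} {k} v = mk⇔
  (λ a i → trans (bits a (toℕ i) (subst (toℕ i <_) (sym (Vₚ.length-toList v)) (toℕ<n i))) (bitAt-toList v i))
  back
  where
  back : (∀ i → bitAt X (k + toℕ i) ≡ lookup v i) → At X k (toList v)
  back b = mkAt λ p p<v → let p<n = subst (p <_) (Vₚ.length-toList v) p<v in
    subst (λ p → bitAt X (k + p) ≡ bitAt (toList v) p) (toℕ-fromℕ< p<n)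
      (trans (b (fromℕ< p<n)) (sym (bitAt-toList v (fromℕ< p<n))))

length-oneHot : ∀ {n} (d : Fin n) → length (oneHot d) ≡ n
length-oneHot d = Vₚ.length-toList (tabulate (λ j → does (d Fin.≟ j)))

At-oneHot : ∀ {X k n} (d : Fin n) → At X k (oneHot d) ⇔ OneHot X k n (toℕ d)
At-oneHot {X} {k} {n} d = At-toList v ⇔∘ mk⇔ forth back
  where
  v = tabulate (λ j → does (d Fin.≟ j))
  forth : (∀ i → bitAt X (k + toℕ i) ≡ lookup v i) → OneHot X k n (toℕ d)
  forth b x x<n = subst (λ x → (bitAt X (k + x) ≡ true → x ≡ toℕ d) × (x ≡ toℕ d → bitAt X (k + x) ≡ true))
    (toℕ-fromℕ< x<n) (hot (fromℕ< x<n))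
    where
    hot : ∀ i → (bitAt X (k + toℕ i) ≡ true → toℕ i ≡ toℕ d) × (toℕ i ≡ toℕ d → bitAt X (k + toℕ i) ≡ true)
    hot i with e ← trans (b i) (Vₚ.lookup∘tabulate (λ j → does (d Fin.≟ j)) i) | d Fin.≟ i
    ... | yes refl = (λ _ → refl) , λ _ → e
    ... | no  d≢i  = (λ t → ⊥-elim (not-¬ t e)) , λ i≡d → ⊥-elim (d≢i (toℕ-injective (sym i≡d)))
  back : OneHot X k n (toℕ d) → ∀ i → bitAt X (k + toℕ i) ≡ lookup v i
  back h i rewrite Vₚ.lookup∘tabulate (λ j → does (d Fin.≟ j)) i with d Fin.≟ i
  ... | yes refl = proj₂ (h (toℕ i) (toℕ<n i)) refl
  ... | no  d≢i  = ¬-not λ t → d≢i (toℕ-injective (sym (proj₁ (h (toℕ i) (toℕ<n i)) t)))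

At-matrix : ∀ {X n m} k (M : Vec (Vec Bool n) m) →
  At X k (toList (V.concat M)) ⇔ (∀ r c → bitAt X (k + toℕ r * n + toℕ c) ≡ lookup (lookup M r) c)
At-matrix k [] = mk⇔ (λ _ ()) (λ _ → mkAt λ _ ())
At-matrix {X} {n} k (row ∷ M) rewrite Vₚ.toList-++ row (V.concat M) =
  At-++ (toList row) (Vₚ.length-toList row) ⇔∘ mk⇔
    (λ (a , b) → λ where
      zero    c → trans (cong (λ k → bitAt X (k + toℕ c)) (+-identityʳ k)) (to (At-toList row) a c)
      (suc r) c → trans (cong (λ k → bitAt X (k + toℕ c)) (sym (+-assoc k n (toℕ r * n)))) (to (At-matrix (k + n) M) b r c))
    (λ f → from (At-toList row) (λ c → trans (cong (λ k → bitAt X (k + toℕ c)) (sym (+-identityʳ k))) (f zero c))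
         , from (At-matrix (k + n) M) (λ r c → trans (cong (λ k → bitAt X (k + toℕ c)) (+-assoc k n (toℕ r * n))) (f (suc r) c)))

encGate : ∀ {m} → Gate m → List Bool
encGate (i , j) = oneHot i ++ oneHot j

At-gates : ∀ {X m} k (gs : List (Gate m)) → At X k (concatMap encGate gs) ⇔
  (∀ t → let (i , j) = L.lookup gs t in
     OneHot X (k + toℕ t * (m + m)) m (toℕ i) × OneHot X (k + toℕ t * (m + m) + m) m (toℕ j))
At-gates k [] = mk⇔ (λ _ ()) (λ _ → mkAt λ _ ())
At-gates {X} {m} k ((i , j) ∷ gs) =
  At-++ (encGate (i , j)) (trans (length-++ (oneHot i)) (cong₂ _+_ (length-oneHot i) (length-oneHot j))) ⇔∘ mk⇔
    (λ (a , b) → λ where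
      zero    → subst GateAt (sym (+-identityʳ k)) (to gate a)
      (suc t) → subst (GateAt′ t) (+-assoc k (m + m) (toℕ t * (m + m))) (to (At-gates (k + (m + m)) gs) b t))
    (λ f → from gate (subst GateAt (+-identityʳ k) (f zero))
         , from (At-gates (k + (m + m)) gs) (λ t → subst (GateAt′ t) (sym (+-assoc k (m + m) (toℕ t * (m + m)))) (f (suc t))))
  where
  GateAt : ℕ → Set
  GateAt k = OneHot X k m (toℕ i) × OneHot X (k + m) m (toℕ j)
  GateAt′ : Fin (length gs) → ℕ → Set
  GateAt′ t k = OneHot X k m (toℕ (proj₁ (L.lookup gs t))) × OneHot X (k + m) m (toℕ (proj₂ (L.lookup gs t)))
  gate : At X k (encGate (i , j)) ⇔ GateAt k
  gate = At-++ (oneHot i) (length-oneHot i) ⇔∘ mk⇔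
    (λ (a , b) → to (At-oneHot i) a , to (At-oneHot j) b)
    (λ (a , b) → from (At-oneHot i) a , from (At-oneHot j) b)

infixl 7 _⊞_
infixl 8 _⊠_
_⊞_ _⊠_ : ∀ {k} → Term k → Term k → Term k
_⊞_ = _⊕_
_⊠_ = _⊗_

onesᶠ : ∀ {k} → Term k → Term k → Fm k
onesᶠ k n = ∀< n (bitᶠ (wkT k ⊞ var zero))

oneHotᶠ : ∀ {k} → Term k → Term k → Term k → Fm k
oneHotᶠ k n d = ∀< n
  ((bitᶠ (wkT k ⊞ var zero) ⇒ᶠ var zero ≐ wkT d) ∧ᶠ (var zero ≐ wkT d ⇒ᶠ bitᶠ (wkT k ⊞ var zero)))

iter : {S : Set} → (ℕ → S → S) → ℕ → S → S
iter f zero    s = s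
iter f (suc t) s = f t (iter f t s)

-- `iter` puts its last step outermost, whereas `lfmStep` and `runCircuit` consume the first row or
-- gate. This passes between the two recursions.
iter-shift : {S : Set} (f : ℕ → S → S) → ∀ t s → iter f (suc t) s ≡ iter (f ∘ suc) t (f 0 s)
iter-shift f zero    s = refl
iter-shift f (suc t) s = cong (f (suc t)) (iter-shift f t s)

-- Graph encodings

gOffset : ℕ → ℕ → ℕ
gOffset m n = m + 1 + n + 1 + n

adjBit : List Bool → ℕ → ℕ → ℕ → ℕ → Bool
adjBit X m n r c = bitAt X (gOffset m n + r * n + c)

-- Only the length of the matrix part is prescribed: every bit matrix is a bipartite graph, so each
-- string of this shape is an encoding (`decodeGraph`).
GShape : List Bool → ℕ → ℕ → ℕ → Set
GShape X m n d =
    Ones X 0 m × (¬ bitAt X m ≡ true) × Ones X (m + 1) n × (¬ bitAt X (m + 1 + n) ≡ true)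
  × d < n × OneHot X (m + 1 + n + 1) n d × length X ≡ gOffset m n + m * n

-- Definitionally, ⟦ gShape ⟧ (d ∷ n ∷ m ∷ []) X is GShape X m n d; likewise for cShape below.
gShape : Fm 3
gShape = onesᶠ (lit 0) m ∧ᶠ ¬ᶠ bitᶠ m ∧ᶠ onesᶠ (m ⊞ lit 1) n ∧ᶠ ¬ᶠ bitᶠ (m ⊞ lit 1 ⊞ n)
  ∧ᶠ d ≺ n ∧ᶠ oneHotᶠ (m ⊞ lit 1 ⊞ n ⊞ lit 1) n d ∧ᶠ len ≐ m ⊞ lit 1 ⊞ n ⊞ lit 1 ⊞ n ⊞ m ⊠ n
  where
  d n m : Term 3
  d = var zero
  n = var (suc zero)
  m = var (suc (suc zero))

GShape-unique : ∀ {X m n d m′ n′ d′} → GShape X m n d → GShape X m′ n′ d′ → m ≡ m′ × n ≡ n′ × d ≡ d′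
GShape-unique {X} {m} {n} (o , z , o₁ , z₁ , d<n , h , _) (o′ , z′ , o₁′ , z₁′ , _ , h′ , _)
  with refl ← Ones-unique {X} {0} o z o′ z′
  with refl ← Ones-unique {X} {m + 1} o₁ z₁ o₁′ z₁′
  with refl ← OneHot-unique {X} {m + 1 + n + 1} d<n h h′ = refl , refl , refl

length-encGraph : ∀ m n adj d → length (encGraph m n adj d) ≡ gOffset m n + m * n
length-encGraph m n adj d = begin
  length (encGraph m n adj d)
    ≡⟨ length-++ (L.replicate m true) ⟩
  length (L.replicate m true) + suc (length (L.replicate n true ++ false ∷ oneHot d ++ toList (V.concat adj)))
    ≡⟨ cong₂ (λ x y → x + suc y) (length-replicate m) (length-++ (L.replicate n true)) ⟩
  m + suc (length (L.replicate n true) + suc (length (oneHot d ++ toList (V.concat adj))))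
    ≡⟨ cong₂ (λ x y → m + suc (x + suc y)) (length-replicate n) (length-++ (oneHot d)) ⟩
  m + suc (n + suc (length (oneHot d) + length (toList (V.concat adj))))
    ≡⟨ cong₂ (λ x y → m + suc (n + suc (x + y))) (length-oneHot d) (Vₚ.length-toList (V.concat adj)) ⟩
  m + suc (n + suc (n + m * n))
    ≡⟨ assoc m n (m * n) ⟩
  gOffset m n + m * n ∎
  where
  open ≡-Reasoning
  assoc : ∀ m n x → m + suc (n + suc (n + x)) ≡ m + 1 + n + 1 + n + x
  assoc = solve-∀

At-encGraph : ∀ {X} m n adj d → At X 0 (encGraph m n adj d) ⇔
  ( Ones X 0 m × (¬ bitAt X m ≡ true) × Ones X (m + 1) n × (¬ bitAt X (m + 1 + n) ≡ true)
  × OneHot X (m + 1 + n + 1) n (toℕ d) × (∀ r c → adjBit X m n (toℕ r) (toℕ c) ≡ lookup (lookup adj r) c))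
At-encGraph m n adj d = mk⇔
  (λ a → let o , a = to s₁ a ; z , a = to s₂ a ; o₁ , a = to s₃ a ; z₁ , a = to s₄ a ; h , a = to s₅ a in
    to (At-ones m) o , to At-zero z , to (At-ones n) o₁ , to At-zero z₁ , to (At-oneHot d) h , to (At-matrix _ adj) a)
  (λ (o , z , o₁ , z₁ , h , a) → from s₁ (from (At-ones m) o , from s₂ (from At-zero z , from s₃ (from (At-ones n) o₁
    , from s₄ (from At-zero z₁ , from s₅ (from (At-oneHot d) h , from (At-matrix _ adj) a))))))
  where
  s₁ = At-++ (L.replicate m true) (length-replicate m)
  s₂ = At-++ (false ∷ []) refl
  s₃ = At-++ (L.replicate n true) (length-replicate n)
  s₄ = At-++ (false ∷ []) refl
  s₅ = At-++ (oneHot d) (length-oneHot d)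

encGraph-shape : ∀ m n adj d → GShape (encGraph m n adj d) m n (toℕ d)
encGraph-shape m n adj d = let o , z , o₁ , z₁ , h , _ = to (At-encGraph m n adj d) (At-self _) in
  o , z , o₁ , z₁ , toℕ<n d , h , length-encGraph m n adj d

encGraph-adjBit : ∀ m n adj d r c → adjBit (encGraph m n adj d) m n (toℕ r) (toℕ c) ≡ lookup (lookup adj r) c
encGraph-adjBit m n adj d = let _ , _ , _ , _ , _ , a = to (At-encGraph m n adj d) (At-self _) in a

adjacency : (m n : ℕ) → (ℕ → ℕ → Bool) → Vec (Vec Bool n) m
adjacency m n f = tabulate λ r → tabulate λ c → f (toℕ r) (toℕ c)

lookup-adjacency : ∀ m n f r c → lookup (lookup (adjacency m n f) r) c ≡ f (toℕ r) (toℕ c)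
lookup-adjacency m n f r c =
  trans (cong (λ row → lookup row c) (Vₚ.lookup∘tabulate (λ r → tabulate λ c → f (toℕ r) (toℕ c)) r))
    (Vₚ.lookup∘tabulate (λ c → f (toℕ r) (toℕ c)) c)

decodeGraph : ∀ {X m n d} → GShape X m n d → Σ (Fin n) λ i → toℕ i ≡ d × X ≡ encGraph m n (adjacency m n (adjBit X m n)) i
decodeGraph {X} {m} {n} (o , z , o₁ , z₁ , d<n , h , l) = fromℕ< d<n , toℕ-fromℕ< d<n ,
  At-≡ _ (trans l (sym (length-encGraph m n adj (fromℕ< d<n)))) (from (At-encGraph m n adj (fromℕ< d<n))
    (o , z , o₁ , z₁ , subst (OneHot X _ n) (sym (toℕ-fromℕ< d<n)) h
    , λ r c → sym (lookup-adjacency m n (adjBit X m n) r c)))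
  where adj = adjacency m n (adjBit X m n)

-- The pointwise form of `matchFirst`: a row takes `c` when `c` is a free neighbour and all smaller
-- neighbours are taken. If `c` is already taken, the first disjunct hides the second.
matchRow : (ℕ → Bool) → (ℕ → Bool) → ℕ → Bool
matchRow row M c = M c ∨ (row c ∧ allBelow c (λ c′ → not (row c′) ∨ M c′))

matched : (ℕ → ℕ → Bool) → ℕ → ℕ → Bool
matched adj m = iter (λ r → matchRow (adj r)) m (λ _ → false)

allBelow-suc : ∀ n p → allBelow (suc n) p ≡ p 0 ∧ allBelow n (p ∘ suc)
allBelow-suc zero    p = sym (∧-identityʳ (p 0))
allBelow-suc (suc n) p = trans (cong (_∧ p (suc n)) (allBelow-suc n p)) (∧-assoc (p 0) _ _)

matchFirst-lookup : ∀ {n} (a s : Vec Bool n) f g → (∀ c → lookup a c ≡ f (toℕ c)) → (∀ c → lookup s c ≡ g (toℕ c)) →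
  ∀ c → lookup (matchFirst a s) c ≡ matchRow f g (toℕ c)
matchFirst-lookup (a ∷ as) (x ∷ xs) f g ea es zero    rewrite sym (ea zero) | sym (es zero) with a | x
... | true  | true  = refl
... | true  | false = refl
... | false | true  = refl
... | false | false = refl
matchFirst-lookup (a ∷ as) (x ∷ xs) f g ea es (suc c)
  rewrite allBelow-suc (toℕ c) (λ c′ → not (f c′) ∨ g c′) | sym (ea zero) | sym (es zero) with a | x
-- The head is adjacent and free, so it absorbs the row, and the condition on smaller neighbours
-- fails for all later columns.
... | true  | false rewrite ∧-zeroʳ (f (suc (toℕ c))) | ∨-identityʳ (g (suc (toℕ c))) = es (suc c)
... | true  | true  = matchFirst-lookup as xs (f ∘ suc) (g ∘ suc) (ea ∘ suc) (es ∘ suc) c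
... | false | true  = matchFirst-lookup as xs (f ∘ suc) (g ∘ suc) (ea ∘ suc) (es ∘ suc) c
... | false | false = matchFirst-lookup as xs (f ∘ suc) (g ∘ suc) (ea ∘ suc) (es ∘ suc) c

lfmStep-lookup : ∀ {m n} (rows : Vec (Vec Bool n) m) s (f : ℕ → ℕ → Bool) g →
  (∀ r c → lookup (lookup rows r) c ≡ f (toℕ r) (toℕ c)) → (∀ c → lookup s c ≡ g (toℕ c)) →
  ∀ c → lookup (lfmStep rows s) c ≡ iter (λ r → matchRow (f r)) m g (toℕ c)
lfmStep-lookup []           s f g ea es c = es c
lfmStep-lookup {suc m} (row ∷ rows) s f g ea es c =
  trans (lfmStep-lookup rows (matchFirst row s) (f ∘ suc) (matchRow (f 0) g) (ea ∘ suc)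
          (matchFirst-lookup row s (f 0) g (ea zero) es) c)
    (cong (λ M → M (toℕ c)) (sym (iter-shift (λ r → matchRow (f r)) m g)))

lfmMatchedTop-lookup : ∀ {m n} (adj : Vec (Vec Bool n) m) (f : ℕ → ℕ → Bool) → (∀ r c → lookup (lookup adj r) c ≡ f (toℕ r) (toℕ c)) →
  ∀ c → lookup (lfmMatchedTop adj) c ≡ matched f m (toℕ c)
lfmMatchedTop-lookup adj f ea = lfmStep-lookup adj _ f _ ea (λ c → Vₚ.lookup-replicate c false)

VLFMM-shape : ∀ {X} → VLFMM X → Σ ℕ λ m → Σ ℕ λ n → Σ ℕ λ d → GShape X m n d
VLFMM-shape (m , n , adj , d , refl , _) = m , n , toℕ d , encGraph-shape m n adj d

VLFMM-semantics : ∀ {X m n d} → GShape X m n d → VLFMM X ⇔ (matched (adjBit X m n) m d ≡ true)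
VLFMM-semantics {X} {m} {n} {d} sh = mk⇔ forth back
  where
  forth : VLFMM X → matched (adjBit X m n) m d ≡ true
  forth (m′ , n′ , adj , d′ , refl , e)
    with refl , refl , refl ← GShape-unique {X} sh (encGraph-shape m′ n′ adj d′) =
    trans (sym (lfmMatchedTop-lookup adj _ (λ r c → sym (encGraph-adjBit m n adj d′ r c)) d′)) e
  back : matched (adjBit X m n) m d ≡ true → VLFMM X
  back e with i , refl , X≡ ← decodeGraph sh = m , n , adj , i , X≡ ,
    trans (lfmMatchedTop-lookup adj (adjBit X m n) (lookup-adjacency m n (adjBit X m n)) i) e
    where adj = adjacency m n (adjBit X m n)

-- Degree at most three by covering triples

Covers : ℕ → (ℕ → Bool) → ℕ → ℕ → ℕ → Set
Covers n f a b c = ∀ x → x < n → f x ≡ true → x ≡ a ⊎ x ≡ b ⊎ x ≡ c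

predecessors : List ℕ → List ℕ
predecessors []           = []
predecessors (zero ∷ L)   = predecessors L
predecessors (suc a ∷ L)  = a ∷ predecessors L

predecessors-∈ : ∀ {x L} → suc x ∈ L → x ∈ predecessors L
predecessors-∈ {L = zero ∷ L}  (there x∈L)  = predecessors-∈ x∈L
predecessors-∈ {L = suc a ∷ L} (here refl)  = here refl
predecessors-∈ {L = suc a ∷ L} (there x∈L)  = there (predecessors-∈ x∈L)

predecessors-length : ∀ L → length (predecessors L) ≤ length L
predecessors-length []          = z≤n
predecessors-length (zero ∷ L)  = m≤n⇒m≤1+n (predecessors-length L)
predecessors-length (suc a ∷ L) = s≤s (predecessors-length L)

predecessors-length-< : ∀ {L} → 0 ∈ L → length (predecessors L) < length L
predecessors-length-< {zero ∷ L}  _           = s≤s (predecessors-length L)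
predecessors-length-< {suc a ∷ L} (there 0∈L) = s≤s (predecessors-length-< 0∈L)

-- A pigeonhole argument by shifting: passing to the tail turns `L` into `predecessors L`, and a
-- true head forces a 0 in `L`, which the shift drops. Each true entry thus costs at least one
-- element of the list.
ones-≤ : ∀ {n} (v : Vec Bool n) L → (∀ i → lookup v i ≡ true → toℕ i ∈ L) → ones v ≤ length L
ones-≤ []          L cov = z≤n
ones-≤ (false ∷ v) L cov =
  ≤-trans (ones-≤ v (predecessors L) (λ i e → predecessors-∈ (cov (suc i) e))) (predecessors-length L)
ones-≤ (true ∷ v)  L cov =
  ≤-trans (s≤s (ones-≤ v (predecessors L) (λ i e → predecessors-∈ (cov (suc i) e)))) (predecessors-length-< (cov zero refl))

positions : ∀ {n} → Vec Bool n → List ℕ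
positions []          = []
positions (true ∷ v)  = 0 ∷ L.map suc (positions v)
positions (false ∷ v) = L.map suc (positions v)

positions-length : ∀ {n} (v : Vec Bool n) → length (positions v) ≡ ones v
positions-length []          = refl
positions-length (true ∷ v)  = cong suc (trans (length-map suc (positions v)) (positions-length v))
positions-length (false ∷ v) = trans (length-map suc (positions v)) (positions-length v)

positions-∈ : ∀ {n} (v : Vec Bool n) i → lookup v i ≡ true → toℕ i ∈ positions v
positions-∈ (true ∷ v)  zero    e = here refl
positions-∈ (true ∷ v)  (suc i) e = there (∈-map⁺ suc (positions-∈ v i e))
positions-∈ (false ∷ v) (suc i) e = ∈-map⁺ suc (positions-∈ v i e)

positions-≤ : ∀ {n} (v : Vec Bool n) {x} → x ∈ positions v → x ≤ n
positions-≤ (true ∷ v)  (here refl) = z≤n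
positions-≤ (true ∷ v)  (there x∈)  with y , y∈ , refl ← ∈-map⁻ suc x∈ = s≤s (positions-≤ v y∈)
positions-≤ (false ∷ v) x∈          with y , y∈ , refl ← ∈-map⁻ suc x∈ = s≤s (positions-≤ v y∈)

ones-≤3 : ∀ {n a b c} (v : Vec Bool n) f → (∀ i → lookup v i ≡ f (toℕ i)) → Covers n f a b c → ones v ≤ 3
ones-≤3 {n} {a} {b} {c} v f ev cov = ones-≤ v (a ∷ b ∷ c ∷ []) λ i e → split (cov (toℕ i) (toℕ<n i) (trans (sym (ev i)) e))
  where
  split : ∀ {x} → x ≡ a ⊎ x ≡ b ⊎ x ≡ c → x ∈ a ∷ b ∷ c ∷ []
  split (inj₁ e)        = here e
  split (inj₂ (inj₁ e)) = there (here e)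
  split (inj₂ (inj₂ e)) = there (there (here e))

ones-≤3⁻ : ∀ {n} (v : Vec Bool n) f → (∀ i → lookup v i ≡ f (toℕ i)) → ones v ≤ 3 →
  Σ ℕ λ a → a ≤ n × Σ ℕ λ b → b ≤ n × Σ ℕ λ c → c ≤ n × Covers n f a b c
ones-≤3⁻ {n} v f ev v≤3 = pad (positions v) (subst (_≤ 3) (sym (positions-length v)) v≤3) (positions-≤ v) cov
  where
  cov : ∀ x → x < n → f x ≡ true → x ∈ positions v
  cov x x<n e = subst (_∈ positions v) (toℕ-fromℕ< x<n) (positions-∈ v (fromℕ< x<n)
    (trans (ev (fromℕ< x<n)) (trans (cong f (toℕ-fromℕ< x<n)) e)))
  pad : ∀ L → length L ≤ 3 → (∀ {x} → x ∈ L → x ≤ n) → (∀ x → x < n → f x ≡ true → x ∈ L) →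
    Σ ℕ λ a → a ≤ n × Σ ℕ λ b → b ≤ n × Σ ℕ λ c → c ≤ n × Covers n f a b c
  pad [] _ _ cov = 0 , z≤n , 0 , z≤n , 0 , z≤n , λ x x<n e → case cov x x<n e of λ ()
  pad (a ∷ []) _ bd cov = a , bd (here refl) , 0 , z≤n , 0 , z≤n , λ x x<n e → case cov x x<n e of λ where
    (here e) → inj₁ e
  pad (a ∷ b ∷ []) _ bd cov = a , bd (here refl) , b , bd (there (here refl)) , 0 , z≤n , λ x x<n e → case cov x x<n e of λ where
    (here e)         → inj₁ e
    (there (here e)) → inj₂ (inj₁ e)
  pad (a ∷ b ∷ c ∷ []) _ bd cov = a , bd (here refl) , b , bd (there (here refl)) , c , bd (there (there (here refl)))
    , λ x x<n e → case cov x x<n e of λ where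
    (here e)                 → inj₁ e
    (there (here e))         → inj₂ (inj₁ e)
    (there (there (here e))) → inj₂ (inj₂ e)
  pad (_ ∷ _ ∷ _ ∷ _ ∷ _) (s≤s (s≤s (s≤s ())))

lookup-transpose : ∀ {m n} (A : Vec (Vec Bool n) m) r c → lookup (lookup (transpose A) c) r ≡ lookup (lookup A r) c
lookup-transpose {suc m} {n} (as ∷ ass) r c = trans (cong (λ col → lookup col r) column) (entry r)
  where
  cons : Bool → Vec Bool m → Vec Bool (suc m)
  cons = _∷_
  column : lookup (transpose (as ∷ ass)) c ≡ lookup as c ∷ lookup (transpose ass) c
  column = trans (Vₚ.lookup-⊛ c (V.replicate n cons V.⊛ as) (transpose ass))
    (cong (λ (f : Vec Bool m → Vec Bool (suc m)) → f (lookup (transpose ass) c))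
      (trans (Vₚ.lookup-⊛ c (V.replicate n cons) as)
        (cong (λ (f : Bool → Vec Bool m → Vec Bool (suc m)) → f (lookup as c)) (Vₚ.lookup-replicate c cons))))
  entry : ∀ r → lookup (lookup as c ∷ lookup (transpose ass) c) r ≡ lookup (lookup (as ∷ ass) r) c
  entry zero    = refl
  entry (suc r) = lookup-transpose ass r c

-- Counting is replaced by three covering indices, possibly equal or not neighbours at all. `N`
-- makes the quantifiers over them bounded; in use it is the length of the input or output string.
Degree≤3 : ℕ → ℕ → ℕ → (ℕ → ℕ → Bool) → Set
Degree≤3 N m n adj =
    (∀ r → r < m → Σ ℕ λ a → a < N × Σ ℕ λ b → b < N × Σ ℕ λ c → c < N × Covers n (adj r) a b c)
  × (∀ x → x < n → Σ ℕ λ a → a < N × Σ ℕ λ b → b < N × Σ ℕ λ c → c < N × Covers m (λ r → adj r x) a b c)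

MaxDeg3⇔ : ∀ {N m n} (A : Vec (Vec Bool n) m) f → (∀ r c → lookup (lookup A r) c ≡ f (toℕ r) (toℕ c)) → m < N → n < N →
  MaxDeg3 A ⇔ Degree≤3 N m n f
MaxDeg3⇔ {N} {m} {n} A f eA m<N n<N = mk⇔
  (λ (rows , cols) →
      (λ r r<m → widen n<N (subst (λ r → Cov n (f r)) (toℕ-fromℕ< r<m)
        (ones-≤3⁻ (lookup A (fromℕ< r<m)) (f (toℕ (fromℕ< r<m))) (eA (fromℕ< r<m)) (lookup⁺ rows (fromℕ< r<m)))))
    , (λ c c<n → widen m<N (subst (λ c → Cov m (λ r → f r c)) (toℕ-fromℕ< c<n)
        (ones-≤3⁻ (lookup (transpose A) (fromℕ< c<n)) (λ r → f r (toℕ (fromℕ< c<n))) (eAᵀ (fromℕ< c<n)) (lookup⁺ cols (fromℕ< c<n))))))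
  (λ (rows , cols) →
      lookup⁻ (λ r → let a , _ , b , _ , c , _ , cov = rows (toℕ r) (toℕ<n r) in ones-≤3 (lookup A r) (f (toℕ r)) (eA r) cov)
    , lookup⁻ (λ c → let a , _ , b , _ , d , _ , cov = cols (toℕ c) (toℕ<n c) in ones-≤3 (lookup (transpose A) c) (λ r → f r (toℕ c)) (eAᵀ c) cov))
  where
  Cov : ℕ → (ℕ → Bool) → Set
  Cov n f = Σ ℕ λ a → a ≤ n × Σ ℕ λ b → b ≤ n × Σ ℕ λ c → c ≤ n × Covers n f a b c
  widen : ∀ {k f} → k < N → Cov k f → Σ ℕ λ a → a < N × Σ ℕ λ b → b < N × Σ ℕ λ c → c < N × Covers k f a b c
  widen k<N (a , p , b , q , c , r , cov) = a , ≤-<-trans p k<N , b , ≤-<-trans q k<N , c , ≤-<-trans r k<N , cov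
  eAᵀ : ∀ c r → lookup (lookup (transpose A) c) r ≡ f (toℕ r) (toℕ c)
  eAᵀ c r = trans (lookup-transpose A r c) (eA r c)

GShape-m< : ∀ {X m n d} → GShape X m n d → m < length X
GShape-m< {X} {m} {n} (_ , _ , _ , _ , _ , _ , l) = subst (m <_) (sym l) (subst (m <_) (assoc m n (m * n)) (m<m+n m z<s))
  where
  assoc : ∀ m n x → m + suc (n + 1 + n + x) ≡ m + 1 + n + 1 + n + x
  assoc = solve-∀

GShape-n< : ∀ {X m n d} → GShape X m n d → n < length X
GShape-n< {X} {m} {n} (_ , _ , _ , _ , _ , _ , l) = subst (n <_) (sym l) (subst (n <_) (assoc m n (m * n)) (m<m+n n z<s))
  where
  assoc : ∀ m n x → n + suc (m + 1 + n + x) ≡ m + 1 + n + 1 + n + x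
  assoc = solve-∀

V3LFMM⇔ : ∀ {X m n d} → GShape X m n d → V3LFMM X ⇔ (Degree≤3 (length X) m n (adjBit X m n) × VLFMM X)
V3LFMM⇔ {X} {m} {n} {d} sh = mk⇔ forth back
  where
  deg : ∀ adj → (∀ r c → lookup (lookup adj r) c ≡ adjBit X m n (toℕ r) (toℕ c)) →
    MaxDeg3 adj ⇔ Degree≤3 (length X) m n (adjBit X m n)
  deg adj e = MaxDeg3⇔ adj (adjBit X m n) e (GShape-m< {X} sh) (GShape-n< {X} sh)
  forth : V3LFMM X → Degree≤3 (length X) m n (adjBit X m n) × VLFMM X
  forth (m′ , n′ , adj , d′ , refl , md , e)
    with refl , refl , refl ← GShape-unique {X} sh (encGraph-shape m′ n′ adj d′) =
    to (deg adj (λ r c → sym (encGraph-adjBit m n adj d′ r c))) md , (m , n , adj , d′ , refl , e)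
  back : Degree≤3 (length X) m n (adjBit X m n) × VLFMM X → V3LFMM X
  back (dg , (m′ , n′ , adj , d′ , refl , e))
    with refl , refl , refl ← GShape-unique {X} sh (encGraph-shape m′ n′ adj d′) =
    m , n , adj , d′ , refl , from (deg adj (λ r c → sym (encGraph-adjBit m n adj d′ r c))) dg , e

-- Circuit encodings

cOffset : ℕ → ℕ
cOffset m = m + 1 + m + m

GateAt : List Bool → ℕ → ℕ → ℕ → ℕ → Set
GateAt X m t i j = OneHot X (cOffset m + t * (m + m)) m i × OneHot X (cOffset m + t * (m + m) + m) m j

-- Unlike a matrix, the tail of a circuit encoding is constrained: each block must consist of two
-- one-hot words. The number of gates is not written down and is recovered from the length.
CShape : List Bool → ℕ → ℕ → ℕ → Set
CShape X m G d =
    Ones X 0 m × (¬ bitAt X m ≡ true) × d < m × OneHot X (m + 1 + m) m d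
  × (∀ t → t < G → Σ ℕ λ i → i < m × Σ ℕ λ j → j < m × GateAt X m t i j)
  × length X ≡ cOffset m + G * (m + m)

cShape : Fm 3
cShape = onesᶠ (lit 0) m ∧ᶠ ¬ᶠ bitᶠ m ∧ᶠ d ≺ m ∧ᶠ oneHotᶠ (m ⊞ lit 1 ⊞ m) m d
  ∧ᶠ ∀< G (∃< (wkT m) (∃< (wkT (wkT m)) (oneHotᶠ gate m′ (var (suc zero)) ∧ᶠ oneHotᶠ (gate ⊞ m′) m′ (var zero))))
  ∧ᶠ len ≐ m ⊞ lit 1 ⊞ m ⊞ m ⊞ G ⊠ (m ⊞ m)
  where
  d G m : Term 3
  d = var zero
  G = var (suc zero)
  m = var (suc (suc zero))
  m′ gate : Term 6
  m′   = wkT (wkT (wkT m))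
  gate = m′ ⊞ lit 1 ⊞ m′ ⊞ m′ ⊞ var (suc (suc zero)) ⊠ (m′ ⊞ m′)

CShape-unique : ∀ {X m G d m′ G′ d′} → CShape X m G d → CShape X m′ G′ d′ → m ≡ m′ × G ≡ G′ × d ≡ d′
CShape-unique {X} {m} {G} {G′ = G′} (o , z , d<m , h , _ , l) (o′ , z′ , d′<m , h′ , _ , l′)
  with refl ← Ones-unique {X} {0} o z o′ z′
  with refl ← OneHot-unique {X} {m + 1 + m} d<m h h′
  -- `d < m` makes the block length `m + m` positive, so the total length determines the number of
  -- blocks.
  with refl ← *-cancelʳ-≡ G G′ (m + m) {{>-nonZero (≤-trans (≤-<-trans z≤n d<m) (m≤m+n m m))}} (+-cancelˡ-≡ (cOffset m) _ _ (trans (sym l) l′)) = refl , refl , refl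

length-gates : ∀ {m} (gs : List (Gate m)) → length (concatMap encGate gs) ≡ length gs * (m + m)
length-gates []             = refl
length-gates ((i , j) ∷ gs) = trans (length-++ (encGate (i , j)))
  (cong₂ _+_ (trans (length-++ (oneHot i)) (cong₂ _+_ (length-oneHot i) (length-oneHot j))) (length-gates gs))

length-encCcv : ∀ m gs inp d → length (encCcv m gs inp d) ≡ cOffset m + length gs * (m + m)
length-encCcv m gs inp d = begin
  length (encCcv m gs inp d)
    ≡⟨ length-++ (L.replicate m true) ⟩
  length (L.replicate m true) + suc (length (toList inp ++ oneHot d ++ concatMap encGate gs))
    ≡⟨ cong₂ (λ x y → x + suc y) (length-replicate m) (length-++ (toList inp)) ⟩
  m + suc (length (toList inp) + length (oneHot d ++ concatMap encGate gs))
    ≡⟨ cong₂ (λ x y → m + suc (x + y)) (Vₚ.length-toList inp) (length-++ (oneHot d)) ⟩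
  m + suc (m + (length (oneHot d) + length (concatMap encGate gs)))
    ≡⟨ cong₂ (λ x y → m + suc (m + (x + y))) (length-oneHot d) (length-gates gs) ⟩
  m + suc (m + (m + length gs * (m + m)))
    ≡⟨ assoc m (length gs * (m + m)) ⟩
  cOffset m + length gs * (m + m) ∎
  where
  open ≡-Reasoning
  assoc : ∀ m x → m + suc (m + (m + x)) ≡ m + 1 + m + m + x
  assoc = solve-∀

At-encCcv : ∀ {X} m gs inp d → At X 0 (encCcv m gs inp d) ⇔
  ( Ones X 0 m × (¬ bitAt X m ≡ true) × (∀ w → bitAt X (m + 1 + toℕ w) ≡ lookup inp w) × OneHot X (m + 1 + m) m (toℕ d)
  × (∀ t → GateAt X m (toℕ t) (toℕ (proj₁ (L.lookup gs t))) (toℕ (proj₂ (L.lookup gs t)))))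
At-encCcv m gs inp d = mk⇔
  (λ a → let o , a = to s₁ a ; z , a = to s₂ a ; i , a = to s₃ a ; h , a = to s₄ a in
    to (At-ones m) o , to At-zero z , to (At-toList inp) i , to (At-oneHot d) h , to (At-gates _ gs) a)
  (λ (o , z , i , h , a) → from s₁ (from (At-ones m) o , from s₂ (from At-zero z , from s₃ (from (At-toList inp) i
    , from s₄ (from (At-oneHot d) h , from (At-gates _ gs) a)))))
  where
  s₁ = At-++ (L.replicate m true) (length-replicate m)
  s₂ = At-++ (false ∷ []) refl
  s₃ = At-++ (toList inp) (Vₚ.length-toList inp)
  s₄ = At-++ (oneHot d) (length-oneHot d)

≡ᵇ-true : ∀ {m n} → m ≡ n → (m ≡ᵇ n) ≡ true
≡ᵇ-true {m} {n} e = to T-≡ (≡⇒≡ᵇ m n e)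

≡ᵇ-false : ∀ {m n} → m ≢ n → (m ≡ᵇ n) ≡ false
≡ᵇ-false {m} {n} m≢n = ¬-not (m≢n ∘ ≡ᵇ⇒≡ m n ∘ from T-≡)

-- `j` is tested first because `applyGate` writes it last. For i = j the disjunction therefore wins,
-- and the gate is idle.
gateStep : ℕ → ℕ → (ℕ → Bool) → ℕ → Bool
gateStep i j V w = if w ≡ᵇ j then V i ∨ V j else (if w ≡ᵇ i then V i ∧ V j else V w)

gateStep-or : ∀ i j V → gateStep i j V j ≡ V i ∨ V j
gateStep-or i j V rewrite ≡ᵇ-true {j} refl = refl

gateStep-and : ∀ i j V → i ≢ j → gateStep i j V i ≡ V i ∧ V j
gateStep-and i j V i≢j rewrite ≡ᵇ-false i≢j | ≡ᵇ-true {i} refl = refl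

gateStep-other : ∀ i j V {w} → w ≢ i → w ≢ j → gateStep i j V w ≡ V w
gateStep-other i j V w≢i w≢j rewrite ≡ᵇ-false w≢j | ≡ᵇ-false w≢i = refl

run : (I J : ℕ → ℕ) → (ℕ → Bool) → ℕ → ℕ → Bool
run I J inp G = iter (λ t → gateStep (I t) (J t)) G inp

applyGate-lookup : ∀ {m} (v : Vec Bool m) i j V → (∀ w → lookup v w ≡ V (toℕ w)) →
  ∀ w → lookup (applyGate v (i , j)) w ≡ gateStep (toℕ i) (toℕ j) V (toℕ w)
applyGate-lookup v i j V e w with w Fin.≟ j
... | yes refl = trans (Vₚ.lookup∘update j (v V.[ i ]≔ _) _)
  (trans (cong₂ _∨_ (e i) (e j)) (sym (gateStep-or (toℕ i) (toℕ j) V)))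
... | no  w≢j with w Fin.≟ i
...   | yes refl = trans (Vₚ.lookup∘update′ w≢j (v V.[ i ]≔ _) _) (trans (Vₚ.lookup∘update i v _)
  (trans (cong₂ _∧_ (e i) (e j)) (sym (gateStep-and (toℕ i) (toℕ j) V (w≢j ∘ toℕ-injective)))))
...   | no  w≢i = trans (Vₚ.lookup∘update′ w≢j (v V.[ i ]≔ _) _) (trans (Vₚ.lookup∘update′ w≢i v _)
  (trans (e w) (sym (gateStep-other (toℕ i) (toℕ j) V (w≢i ∘ toℕ-injective) (w≢j ∘ toℕ-injective)))))

runCircuit-lookup : ∀ {m} (gs : List (Gate m)) v I J V →
  (∀ t → toℕ (proj₁ (L.lookup gs t)) ≡ I (toℕ t)) → (∀ t → toℕ (proj₂ (L.lookup gs t)) ≡ J (toℕ t)) →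
  (∀ w → lookup v w ≡ V (toℕ w)) → ∀ w → lookup (runCircuit gs v) w ≡ run I J V (length gs) (toℕ w)
runCircuit-lookup []             v I J V eI eJ e w = e w
runCircuit-lookup ((i , j) ∷ gs) v I J V eI eJ e w =
  trans (runCircuit-lookup gs (applyGate v (i , j)) (I ∘ suc) (J ∘ suc) (gateStep (I 0) (J 0) V) (eI ∘ suc) (eJ ∘ suc)
          (λ w → trans (applyGate-lookup v i j V e w) (cong₂ (λ i j → gateStep i j V (toℕ w)) (eI zero) (eJ zero))) w)
    (cong (λ M → M (toℕ w)) (sym (iter-shift (λ t → gateStep (I t) (J t)) (length gs) V)))

encCcv-shape : ∀ m gs inp d → CShape (encCcv m gs inp d) m (length gs) (toℕ d)
encCcv-shape m gs inp d = let o , z , _ , h , g = to (At-encCcv m gs inp d) (At-self _) in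
  o , z , toℕ<n d , h
  , (λ t t<G → let (i , j) = L.lookup gs (fromℕ< t<G) in toℕ i , toℕ<n i , toℕ j , toℕ<n j
      , subst (λ t′ → GateAt (encCcv m gs inp d) m t′ (toℕ i) (toℕ j)) (toℕ-fromℕ< t<G) (g (fromℕ< t<G)))
  , length-encCcv m gs inp d

CCV-shape : ∀ {X} → CCV X → Σ ℕ λ m → Σ ℕ λ G → Σ ℕ λ d → CShape X m G d
CCV-shape (m , gs , inp , d , refl , _) = m , length gs , toℕ d , encCcv-shape m gs inp d

inputBit : List Bool → ℕ → ℕ → Bool
inputBit X m w = bitAt X (m + 1 + w)

lookup-tabulateᴸ : ∀ {A : Set} {n} (f : Fin n → A) t → Σ (Fin n) λ s → toℕ s ≡ toℕ t × L.lookup (L.tabulate f) t ≡ f s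
lookup-tabulateᴸ {n = suc n} f zero    = zero , refl , refl
lookup-tabulateᴸ {n = suc n} f (suc t) with s , s≡t , e ← lookup-tabulateᴸ (f ∘ suc) t = suc s , cong suc s≡t , e

-- The endpoints enter as total functions constrained only below `G`. The one-hot words fix them
-- there, so each reduction can supply endpoint functions in its own form.
CCV-semantics : ∀ {X m G d} → CShape X m G d → ∀ I J →
  (∀ t → t < G → I t < m × J t < m × GateAt X m t (I t) (J t)) →
  CCV X ⇔ (run I J (inputBit X m) G d ≡ true)
CCV-semantics {X} {m} {G} {d} sh I J gates = mk⇔ forth back
  where
  forth : CCV X → run I J (inputBit X m) G d ≡ true
  forth (m′ , gs , inp , d′ , refl , e)
    with refl , refl , refl ← CShape-unique {X} sh (encCcv-shape m′ gs inp d′)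
    with _ , _ , i , _ , g ← to (At-encCcv m gs inp d′) (At-self X) =
    trans (sym (runCircuit-lookup gs inp I J _
      (λ t → let _ , _ , hI , _ = gates (toℕ t) (toℕ<n t) in
         OneHot-unique {X} {cOffset m + toℕ t * (m + m)} (toℕ<n _) (proj₁ (g t)) hI)
      (λ t → let _ , _ , _ , hJ = gates (toℕ t) (toℕ<n t) in
         OneHot-unique {X} {cOffset m + toℕ t * (m + m) + m} (toℕ<n _) (proj₂ (g t)) hJ)
      (λ w → sym (i w)) d′)) e
  gate : Fin G → Gate m
  gate t = let I<m , J<m , _ = gates (toℕ t) (toℕ<n t) in fromℕ< I<m , fromℕ< J<m
  gs  = L.tabulate gate
  inp = tabulate {n = m} (λ w → inputBit X m (toℕ w))
  |gs| : length gs ≡ G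
  |gs| = length-tabulate gate
  lookup-gs : ∀ t → toℕ (proj₁ (L.lookup gs t)) ≡ I (toℕ t) × toℕ (proj₂ (L.lookup gs t)) ≡ J (toℕ t)
  lookup-gs t with s , s≡t , e ← lookup-tabulateᴸ gate t rewrite e | sym s≡t = toℕ-fromℕ< _ , toℕ-fromℕ< _
  lookup-inp : ∀ w → lookup inp w ≡ inputBit X m (toℕ w)
  lookup-inp = Vₚ.lookup∘tabulate (λ w → inputBit X m (toℕ w))
  back : run I J (inputBit X m) G d ≡ true → CCV X
  back e = let o , z , d<m , h , _ , l = sh in m , gs , inp , fromℕ< d<m
    , At-≡ _ (trans l (sym (trans (length-encCcv m gs inp (fromℕ< d<m)) (cong (λ G → cOffset m + G * (m + m)) |gs|))))
        (from (At-encCcv m gs inp (fromℕ< d<m))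
          ( o , z , (λ w → sym (lookup-inp w)) , subst (OneHot X (m + 1 + m) m) (sym (toℕ-fromℕ< d<m)) h
          , λ t → let _ , _ , hot = gates (toℕ t) (subst (toℕ t <_) |gs| (toℕ<n t)) ; eI , eJ = lookup-gs t in
              subst₂ (GateAt X m (toℕ t)) (sym eI) (sym eJ) hot ))
    , trans (runCircuit-lookup gs inp I J (inputBit X m) (proj₁ ∘ lookup-gs) (proj₂ ∘ lookup-gs) lookup-inp (fromℕ< d<m))
        (trans (cong₂ (run I J (inputBit X m)) |gs| (toℕ-fromℕ< d<m)) e)

-- From degree three to arbitrary degree

GShape-bounded : ∀ {X m n d} → GShape X m n d → ∀ i → lookup (d ∷ n ∷ m ∷ []) i < length X
GShape-bounded {X} sh@(_ , _ , _ , _ , d<n , _) = λ where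
  zero             → <-trans d<n (GShape-n< {X} sh)
  (suc zero)       → GShape-n< {X} sh
  (suc (suc zero)) → GShape-m< {X} sh

GShape-params-unique : ∀ X ρ ρ′ → ⟦ gShape ⟧ ρ X → ⟦ gShape ⟧ ρ′ X → ρ ≡ ρ′
GShape-params-unique X (d ∷ n ∷ m ∷ []) (d′ ∷ n′ ∷ m′ ∷ []) sh sh′
  with refl , refl , refl ← GShape-unique {X} sh sh′ = refl

-- Every encoding contains a separator, so the empty string is a safe image for malformed inputs.
¬VLFMM-[] : ¬ VLFMM []
¬VLFMM-[] V with m , n , d , (_ , _ , _ , _ , _ , _ , l) ← VLFMM-shape V = case trans l (assoc m n (m * n)) of λ ()
  where
  assoc : ∀ m n x → m + 1 + n + 1 + n + x ≡ suc (m + n + 1 + n + x)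
  assoc = solve-∀

V3LFMM⇒VLFMM : ∀ {X} → V3LFMM X → VLFMM X
V3LFMM⇒VLFMM (m , n , adj , d , e , _ , t) = m , n , adj , d , e , t

-- In the innermost scope variable 0 is the inner index, 3, 2 and 1 are the covering indices, 4 is
-- the outer index, and 5, 6, 7 are `d`, `n`, `m`. The two conjuncts exchange the roles of row and
-- column.
degree≤3 : Fm 3
degree≤3 =
    ∀< m (∃< len (∃< len (∃< len (∀< (var (# 5)) (bitᶠ (entry (v 4) (v 0)) ⇒ᶠ covered)))))
  ∧ᶠ ∀< n (∃< len (∃< len (∃< len (∀< (var (# 6)) (bitᶠ (entry (v 0) (v 4)) ⇒ᶠ covered)))))
  where
  n m : Term 3
  n = var (suc zero)
  m = var (suc (suc zero))
  v : (i : ℕ) → {True (i <? 8)} → Term 8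
  v i {p} = var (#_ i {m<n = p})
  covered : Fm 8
  covered = v 0 ≐ v 3 ∨ᶠ v 0 ≐ v 2 ∨ᶠ v 0 ≐ v 1
  entry : Term 8 → Term 8 → Term 8
  entry r c = v 7 ⊞ lit 1 ⊞ v 6 ⊞ lit 1 ⊞ v 6 ⊞ r ⊠ v 6 ⊞ c

wholeInput : DefList 3
wholeInput = tabᴸ len (bitᶠ (var zero))

wholeInput-list : ∀ ρ X → list wholeInput ρ X ≡ X
wholeInput-list ρ X = bits-ext _ X (length-applyUpTo (bitAt X) (length X)) (λ p p<X → bitAt-applyUpTo (bitAt X) (length X) p<X)

-- The identity on graphs within the degree bound. The bound belongs to the shape, because a graph
-- that violates it may well have its node matched and must not be passed on.
V3LFMM≤VLFMM : V3LFMM ≤AC0 VLFMM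
V3LFMM≤VLFMM = Reduction.reduction {V3LFMM} {VLFMM} (gShape ∧ᶠ degree≤3) wholeInput
  (λ { X (d ∷ n ∷ m ∷ []) (sh , _) → GShape-bounded {X} sh })
  (λ X ρ ρ′ (sh , _) (sh′ , _) → GShape-params-unique X ρ ρ′ sh sh′)
  (λ X V3 → let m , n , d , sh = VLFMM-shape (V3LFMM⇒VLFMM V3) in
    d ∷ n ∷ m ∷ [] , sh , proj₁ (to (V3LFMM⇔ {X} sh) V3))
  ¬VLFMM-[]
  λ { X ρ@(d ∷ n ∷ m ∷ []) (sh , deg) → subst (λ Y → V3LFMM X ⇔ VLFMM Y) (sym (wholeInput-list ρ X))
      (mk⇔ V3LFMM⇒VLFMM (λ V → from (V3LFMM⇔ {X} sh) (deg , V))) }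

-- From matchings to circuits

module MatchingByGates
  (m n : ℕ) (adj : ℕ → ℕ → Bool) (inp : ℕ → Bool) (I J : ℕ → ℕ)
  (inp-bottom : ∀ w → w < m → inp w ≡ true)
  (inp-top    : ∀ c → c < n → inp (m + c) ≡ false)
  (I-gate     : ∀ r c → r < m → c < n → I (r * n + c) ≡ r)
  (J-gate     : ∀ r c → r < m → c < n → J (r * n + c) ≡ (if adj r c then m + c else r))
  where

  -- The value of wire `r` before column `c`: the token is still there when every neighbour met so
  -- far was already taken.
  blocked : ℕ → ℕ → Bool
  blocked r c = allBelow c (λ c′ → not (adj r c′) ∨ matched adj r c′)

  record RowStart (r : ℕ) (V : ℕ → Bool) : Set where
    field
      bottoms : ∀ w → r ≤ w → w < m → V w ≡ true
      tops    : ∀ c → c < n → V (m + c) ≡ matched adj r c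

  -- In the middle of a row the top wires below `c` show the state after the row, those from `c` on
  -- the state before it. Wires of finished rows are never touched again and do not occur.
  record Within (r c : ℕ) (V : ℕ → Bool) : Set where
    field
      bottoms : ∀ w → r < w → w < m → V w ≡ true
      current : V r ≡ blocked r c
      done    : ∀ c′ → c′ < c → V (m + c′) ≡ matched adj (suc r) c′
      ahead   : ∀ c′ → c ≤ c′ → c′ < n → V (m + c′) ≡ matched adj r c′

  m≢bottom : ∀ {w c} → w < m → m + c ≢ w
  m≢bottom w<m refl = m+n≮m m _ w<m

  -- On an edge the conjunction is the recurrence of `blocked` and the disjunction is that of
  -- `matchRow`. On a non-edge both recurrences leave the values alone, as does the gate (r , r).
  step : ∀ r c V → r < m → c < n → Within r c V → Within r (suc c) (gateStep r (if adj r c then m + c else r) V)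
  step r c V r<m c<n W with adj r c in e
  ... | true = record
    { bottoms = λ w r<w w<m → trans (gateStep-other r (m + c) V (>⇒≢ r<w) (m≢bottom w<m ∘ sym)) (bottoms w r<w w<m)
    ; current = trans (gateStep-and r (m + c) V (m≢bottom r<m ∘ sym))
        (trans (cong₂ _∧_ current (ahead c ≤-refl c<n)) (cong (λ a → blocked r c ∧ (not a ∨ matched adj r c)) (sym e)))
    ; done = λ c′ c′<1+c → case m≤n⇒m<n∨m≡n (≤-pred c′<1+c) of λ where
        (inj₁ c′<c) → trans (gateStep-other r (m + c) V (m≢bottom r<m) (<⇒≢ c′<c ∘ +-cancelˡ-≡ m _ _)) (done c′ c′<c)
        (inj₂ refl) → trans (gateStep-or r (m + c) V) (trans (cong₂ _∨_ current (ahead c ≤-refl c<n))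
          (trans (∨-comm (blocked r c) (matched adj r c)) (cong (λ a → matched adj r c ∨ (a ∧ blocked r c)) (sym e))))
    ; ahead = λ c′ c<c′ c′<n →
        trans (gateStep-other r (m + c) V (m≢bottom r<m) (>⇒≢ c<c′ ∘ +-cancelˡ-≡ m _ _)) (ahead c′ (<⇒≤ c<c′) c′<n)
    }
    where open Within W
  ... | false = record
    { bottoms = λ w r<w w<m → trans (gateStep-other r r V (>⇒≢ r<w) (>⇒≢ r<w)) (bottoms w r<w w<m)
    ; current = trans (gateStep-or r r V) (trans (∨-idem (V r)) (trans current
        (trans (sym (∧-identityʳ (blocked r c))) (cong (λ a → blocked r c ∧ (not a ∨ matched adj r c)) (sym e)))))
    ; done = λ c′ c′<1+c → trans (gateStep-other r r V (m≢bottom r<m) (m≢bottom r<m))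
        (case m≤n⇒m<n∨m≡n (≤-pred c′<1+c) of λ where
          (inj₁ c′<c) → done c′ c′<c
          (inj₂ refl) → trans (ahead c ≤-refl c<n) (trans (sym (∨-identityʳ (matched adj r c)))
            (cong (λ a → matched adj r c ∨ (a ∧ blocked r c)) (sym e))))
    ; ahead = λ c′ c<c′ c′<n → trans (gateStep-other r r V (m≢bottom r<m) (m≢bottom r<m)) (ahead c′ (<⇒≤ c<c′) c′<n)
    }
    where open Within W

  within : ∀ r c → r < m → c ≤ n → RowStart r (run I J inp (r * n)) → Within r c (run I J inp (r * n + c))
  within r zero    r<m _   S rewrite +-identityʳ (r * n) = record
    { bottoms = λ w r<w → bottoms w (<⇒≤ r<w)
    ; current = bottoms r ≤-refl r<m
    ; done    = λ _ ()
    ; ahead   = λ c _ → tops c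
    }
    where open RowStart S
  within r (suc c) r<m c<n S rewrite +-suc (r * n) c =
    subst₂ (λ i j → Within r (suc c) (gateStep i j (run I J inp (r * n + c))))
      (sym (I-gate r c r<m c<n)) (sym (J-gate r c r<m c<n)) (step r c _ r<m c<n (within r c r<m (<⇒≤ c<n) S))

  rowStart : ∀ r → r ≤ m → RowStart r (run I J inp (r * n))
  rowStart zero    _   = record { bottoms = λ w _ → inp-bottom w ; tops = inp-top }
  rowStart (suc r) r<m rewrite +-comm n (r * n) = record { bottoms = bottoms ; tops = done }
    where open Within (within r n r<m ≤-refl (rowStart r (<⇒≤ r<m)))

  run-matched : ∀ d → d < n → run I J inp (m * n) (m + d) ≡ matched adj m d
  run-matched = RowStart.tops (rowStart m ≤-refl)

-- The circuit as a definable list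

⊤ᶠ ⊥ᶠ : ∀ {k} → Fm k
⊤ᶠ = lit 0 ≐ lit 0
⊥ᶠ = lit 0 ≐ lit 1

firstᶠ secondᶠ : Fm 6
firstᶠ  = var (# 0) ≐ var (# 2)
secondᶠ = edge ∧ᶠ q ≐ m ⊞ c ∨ᶠ ¬ᶠ edge ∧ᶠ q ≐ r
  where
  q c r n m : Term 6
  q = var (# 0)
  c = var (# 1)
  r = var (# 2)
  n = var (# 4)
  m = var (# 5)
  edge : Fm 6
  edge = bitᶠ (m ⊞ lit 1 ⊞ n ⊞ lit 1 ⊞ n ⊞ r ⊠ n ⊞ c)

circuitOf : DefList 3
circuitOf = tabᴸ M ⊤ᶠ ++ᴸ tabᴸ (lit 1) ⊥ᶠ ++ᴸ (tabᴸ m ⊤ᶠ ++ᴸ tabᴸ n ⊥ᶠ) ++ᴸ tabᴸ M (var zero ≐ wkT (m ⊞ d))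
  ++ᴸ blocksᴸ m (n ⊠ (M ⊞ M)) (blocksᴸ (wkT n) (wkT (M ⊞ M)) gate (λ _ _ _ → refl)) (λ _ _ _ → refl)
  where
  d n m M : Term 3
  d = var zero
  n = var (suc zero)
  m = var (suc (suc zero))
  M = m ⊞ n
  gate : DefList 5
  gate = tabᴸ (wkT (wkT M)) firstᶠ ++ᴸ tabᴸ (wkT (wkT M)) secondᶠ

tab-OneHot : ∀ {Y k N d} {f : ℕ → Bool} → At Y k (applyUpTo f N) → (∀ q → (f q ≡ true) ⇔ (q ≡ d)) → OneHot Y k N d
tab-OneHot {N = N} a e q q<N with b ← At-applyUpTo N a q q<N =
  (λ t → to (e q) (trans (sym b) t)) , λ q≡d → trans b (from (e q) q≡d)

module CircuitOf {X m n d} (sh : GShape X m n d) where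

  M : ℕ
  M = m + n

  Y : List Bool
  Y = list circuitOf (d ∷ n ∷ m ∷ []) X

  d<n : d < n
  d<n = let _ , _ , _ , _ , p , _ = sh in p

  adj : ℕ → ℕ → Bool
  adj = adjBit X m n

  -- Inverts the row-major numbering, since `run` knows a gate only by its index. The pair past the
  -- last gate is an arbitrary default.
  position : ℕ → ℕ × ℕ
  position t with t <? m * n
  ... | yes t<mn = let r , _ , c , _ = split-position m n t t<mn in r , c
  ... | no  _    = 0 , 0

  position-≡ : ∀ r c → r < m → c < n → position (r * n + c) ≡ (r , c)
  position-≡ r c r<m c<n with r * n + c <? m * n
  ... | no ≮ = ⊥-elim (≮ (position-bound r<m c<n))
  ... | yes < with r′ , _ , c′ , c′<n , e ← split-position m n (r * n + c) <
     with refl , refl ← position-unique n r r′ c<n c′<n e = refl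

  second : ℕ → ℕ → ℕ
  second r c = if adj r c then m + c else r

  I J : ℕ → ℕ
  I t = proj₁ (position t)
  J t = second (proj₁ (position t)) (proj₂ (position t))

  offset-≡ : ∀ r c → cOffset M + r * (n * (M + M)) + c * (M + M) ≡ cOffset M + (r * n + c) * (M + M)
  offset-≡ = solved (cOffset M) n (M + M)
    where
    solved : ∀ k n x r c → k + r * (n * x) + c * x ≡ k + (r * n + c) * x
    solved = solve-∀

  env : ℕ → ℕ → ℕ → Vec ℕ 6
  env q c r = q ∷ c ∷ r ∷ d ∷ n ∷ m ∷ []

  wires : Fm 6 → ℕ → ℕ → List Bool
  wires φ r c = applyUpTo (λ q → evalF (compile φ) (env q c r) X) M

  wires-length : ∀ r c → length (wires firstᶠ r c ++ wires secondᶠ r c) ≡ M + M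
  wires-length r c = trans (length-++ (wires firstᶠ r c)) (cong₂ _+_ (length-applyUpTo _ M) (length-applyUpTo _ M))

  second-correct : ∀ r c q → ⟦ secondᶠ ⟧ (env q c r) X ⇔ (q ≡ second r c)
  second-correct r c q with adj r c
  ... | true  = mk⇔ [ proj₂ , (λ (¬e , _) → ⊥-elim (¬e refl)) ] (λ e → inj₁ (refl , e))
  ... | false = mk⇔ [ (λ ()) , proj₂ ] (λ e → inj₂ ((λ ()) , e))

  gateAt : At Y (cOffset M) (concat (applyUpTo (λ r → concat (applyUpTo (λ c → wires firstᶠ r c ++ wires secondᶠ r c) n)) m)) →
    ∀ r c → r < m → c < n → GateAt Y M (r * n + c) r (second r c)
  gateAt a r c r<m c<n
    with a ← At-concat m (λ r → concat-length n (M + M) _ (λ c _ → wires-length r c)) a r r<m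
    with a ← subst (λ k → At Y k (wires firstᶠ r c ++ wires secondᶠ r c)) (offset-≡ r c) (At-concat n (wires-length r) a c c<n)
    with a₁ , a₂ ← to (At-++ (wires firstᶠ r c) {wires secondᶠ r c} (length-applyUpTo _ M)) a =
      tab-OneHot a₁ (λ q → compile-⟦⟧ firstᶠ {env q c r} {X})
    , tab-OneHot a₂ (λ q → compile-⟦⟧ secondᶠ {env q c r} {X} ⇔∘ second-correct r c q)

  record Pieces : Set where
    field
      prefix  : Ones Y 0 M
      zero-at : ¬ bitAt Y M ≡ true
      bottoms : ∀ w → w < m → bitAt Y (M + 1 + w) ≡ true
      tops    : ∀ c → c < n → bitAt Y (M + 1 + m + c) ≡ false
      output  : OneHot Y (M + 1 + M) M (m + d)
      gates   : ∀ r c → r < m → c < n → GateAt Y M (r * n + c) r (second r c)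

  pieces : Pieces
  pieces with a₁ , a ← to (At-++ _ (length-applyUpTo _ M)) (At-self Y)
    with a₂ , a ← to (At-++ (false ∷ []) refl) a
    with a₃ , a ← to (At-++ _ (trans (length-++ (applyUpTo (λ _ → true) m))
                       (cong₂ _+_ (length-applyUpTo _ m) (length-applyUpTo _ n)))) a
    with a₃ , a₄ ← to (At-++ _ (length-applyUpTo _ m)) a₃
    with a₅ , a ← to (At-++ _ (length-applyUpTo _ M)) a = record
    { prefix  = At-applyUpTo M a₁
    ; zero-at = to At-zero a₂
    ; bottoms = At-applyUpTo m a₃
    ; tops    = At-applyUpTo n a₄
    ; output  = tab-OneHot a₅ (λ q → compile-⟦⟧ (var zero ≐ var (suc (suc (suc zero))) ⊞ var (suc zero)) {q ∷ d ∷ n ∷ m ∷ []} {X})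
    ; gates   = gateAt a
    }

  open Pieces pieces

  I-gate : ∀ r c → r < m → c < n → I (r * n + c) ≡ r
  I-gate r c r<m c<n = cong proj₁ (position-≡ r c r<m c<n)

  J-gate : ∀ r c → r < m → c < n → J (r * n + c) ≡ second r c
  J-gate r c r<m c<n = cong (λ (r , c) → second r c) (position-≡ r c r<m c<n)

  second-< : ∀ r c → r < m → c < n → second r c < M
  second-< r c r<m c<n with adj r c
  ... | true  = +-monoʳ-< m c<n
  ... | false = m≤n⇒m≤n+o n r<m

  Y-gates : ∀ t → t < m * n → I t < M × J t < M × GateAt Y M t (I t) (J t)
  Y-gates t t<mn with r , r<m , c , c<n , refl ← split-position m n t t<mn =
    subst₂ (λ i j → i < M × j < M × GateAt Y M (r * n + c) i j) (sym (I-gate r c r<m c<n)) (sym (J-gate r c r<m c<n))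
      (m≤n⇒m≤n+o n r<m , second-< r c r<m c<n , gates r c r<m c<n)

  Y-length : length Y ≡ cOffset M + m * n * (M + M)
  Y-length = trans (length-list circuitOf (d ∷ n ∷ m ∷ []) X) (assoc m n M)
    where
    assoc : ∀ m n M → M + (1 + (m + n + (M + m * (n * (M + M))))) ≡ M + 1 + (m + n) + M + m * n * (M + M)
    assoc = solve-∀

  Y-shape : CShape Y M (m * n) (m + d)
  Y-shape = prefix , zero-at , +-monoʳ-< m d<n , output
    , (λ t t<mn → let I<M , J<M , g = Y-gates t t<mn in I t , I<M , J t , J<M , g) , Y-length

  correct : VLFMM X ⇔ CCV Y
  correct = VLFMM-semantics {X} sh ⇔∘ (mk⇔ (trans rm) (trans (sym rm)) ⇔∘ ⇔-sym (CCV-semantics {Y} Y-shape I J Y-gates))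
    where
    rm = MatchingByGates.run-matched m n adj (inputBit Y M) I J bottoms
      (λ c c<n → trans (cong (bitAt Y) (sym (+-assoc (M + 1) m c))) (tops c c<n)) I-gate J-gate d d<n

¬CCV-[] : ¬ CCV []
¬CCV-[] V with m , G , d , (_ , _ , _ , _ , _ , l) ← CCV-shape V = case trans l (assoc m (G * (m + m))) of λ ()
  where
  assoc : ∀ m x → m + 1 + m + m + x ≡ suc (m + m + m + x)
  assoc = solve-∀

VLFMM≤CCV : VLFMM ≤AC0 CCV
VLFMM≤CCV = Reduction.reduction {VLFMM} {CCV} gShape circuitOf
  (λ { X (d ∷ n ∷ m ∷ []) sh → GShape-bounded {X} sh })
  GShape-params-unique
  (λ X V → let m , n , d , sh = VLFMM-shape V in d ∷ n ∷ m ∷ [] , sh)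
  ¬CCV-[]
  (λ { X (d ∷ n ∷ m ∷ []) sh → CircuitOf.correct {X} sh })

-- From circuits to matchings of degree three

∨-falseʳ : ∀ {a b} → b ≡ false → a ∨ b ≡ a
∨-falseʳ {a} refl = ∨-identityʳ a

matchRow-skip : ∀ (f T : ℕ → Bool) c → f c ≡ false → matchRow f T c ≡ T c
matchRow-skip f T c e rewrite e = ∨-identityʳ (T c)

matchRow-take : ∀ (f T : ℕ → Bool) c {b} → f c ≡ true → allBelow c (λ x → not (f x) ∨ T x) ≡ b → matchRow f T c ≡ T c ∨ b
matchRow-take f T c e e′ rewrite e | e′ = refl

allBelow-among : ∀ c (f T : ℕ → Bool) (P : Set) → ((∀ x → x < c → f x ≡ true → T x ≡ true) ⇔ P) → ∀ {b} → P ⇔ (b ≡ true) →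
  allBelow c (λ x → not (f x) ∨ T x) ≡ b
allBelow-among c f T P e e′ = bool-ext (allBelow-true c ⇔∘ (mk⇔
  (λ g x x<c fx → [ (λ nf → ⊥-elim (to not-true nf fx)) , id ] (to ∨-true (g x x<c)))
  (λ g x x<c → from ∨-true (implies x (g x x<c))) ⇔∘ (e ⇔∘ e′)))
  where
  implies : ∀ x → (f x ≡ true → T x ≡ true) → not (f x) ≡ true ⊎ T x ≡ true
  implies x g with f x
  ... | true  = inj₂ (g refl)
  ... | false = inj₁ refl

-- The copying primitive: a row is pushed past its first neighbour `s` only if `s` is taken, and
-- then fills `a`.
matchRow-second : ∀ (f T : ℕ → Bool) {s a} → s < a → f s ≡ true → f a ≡ true → (∀ x → x < a → f x ≡ true → x ≡ s) →
  matchRow f T a ≡ T a ∨ T s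
matchRow-second f T {s} {a} s<a fs fa only = matchRow-take f T a fa (allBelow-among a f T (T s ≡ true)
  (mk⇔ (λ g → g s s<a fs) (λ Ts x x<a fx → trans (cong T (only x x<a fx)) Ts)) (mk⇔ id id))

-- The conjunction primitive: the third neighbour is reached only past two taken nodes.
matchRow-third : ∀ (f T : ℕ → Bool) {s a b} → s < a → a < b → f s ≡ true → f a ≡ true → f b ≡ true →
  (∀ x → x < b → f x ≡ true → x ≡ s ⊎ x ≡ a) → matchRow f T b ≡ T b ∨ (T s ∧ T a)
matchRow-third f T {s} {a} {b} s<a a<b fs fa fb only = matchRow-take f T b fb
  (allBelow-among b f T (T s ≡ true × T a ≡ true)
    (mk⇔ (λ g → g s (<-trans s<a a<b) fs , g a a<b fa)
         (λ (Ts , Ta) x x<b fx → [ (λ e → trans (cong T e) Ts) , (λ e → trans (cong T e) Ta) ] (only x x<b fx)))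
    (⇔-sym ∧-true))

does-true : {A : Set} (A? : Dec A) → does A? ≡ true → A
does-true (yes a) _ = a

-- The AND output i is fed by the later of the two input rows, which falls
-- through to it exactly when the earlier row has already taken the OR output j.
Last : ℕ → ℕ → ℕ → Set
Last i j w = (w ≡ i × j < i) ⊎ (w ≡ j × i < j)

last? : ∀ i j w → Dec (Last i j w)
last? i j w = (w ≟ i ×-dec j <? i) ⊎-dec (w ≟ j ×-dec i <? j)

redirect : ℕ → ℕ → ℕ → ℕ
redirect i j w = if w ≡ᵇ i then j else w

redirect-≡ : ∀ i j → redirect i j i ≡ j
redirect-≡ i j rewrite ≡ᵇ-true {i} refl = refl

redirect-≢ : ∀ i j {w} → w ≢ i → redirect i j w ≡ w
redirect-≢ i j w≢i rewrite ≡ᵇ-false w≢i = refl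

redirect-< : ∀ {m i j w} → j < m → w < m → redirect i j w < m
redirect-< {i = i} {w = w} j<m w<m with w ≡ᵇ i
... | true  = j<m
... | false = w<m

redirect-same : ∀ i w → redirect i i w ≡ w
redirect-same i w with w ≟ i
... | yes refl = redirect-≡ i i
... | no  w≢i  = redirect-≢ i i w≢i

¬Last-same : ∀ {i w} → ¬ Last i i w
¬Last-same (inj₁ (_ , i<i)) = <-irrefl refl i<i
¬Last-same (inj₂ (_ , i<i)) = <-irrefl refl i<i

-- For i = j the redirection is the identity and `Last` is empty, so the rows merely copy. Copy
-- layers are thus instances of gate layers, and one analysis serves both.
Edge : ℕ → ℕ → ℕ → ℕ → ℕ → ℕ → Set
Edge m k i j w c = c ≡ k * m + w ⊎ c ≡ suc k * m + redirect i j w ⊎ (Last i j w × c ≡ suc (suc k) * m + i)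

-- `A` is the layer being read and `B` the content of the following layer beforehand. After `w`
-- rows, `next w` is that following layer and `carry w` is node `i` two layers on. `carry` consults
-- `next w`, the state just before row `w` adds its own contribution.
module GateLayer (i j : ℕ) (A B : ℕ → Bool) where

  next : ℕ → ℕ → Bool
  next zero    u = B u
  next (suc w) u = next w u ∨ ((u ≡ᵇ redirect i j w) ∧ A w)

  carry : ℕ → Bool
  carry zero    = false
  carry (suc w) = carry w ∨ (does (last? i j w) ∧ (A w ∧ next w (redirect i j w)))

  next-true : ∀ w u → (next w u ≡ true) ⇔ (B u ≡ true ⊎ Σ ℕ λ x → x < w × u ≡ redirect i j x × A x ≡ true)
  next-true zero    u = mk⇔ inj₁ λ { (inj₁ b) → b ; (inj₂ (_ , () , _)) }
  next-true (suc w) u = ∨-true ⇔∘ mk⇔ forth back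
    where
    forth : next w u ≡ true ⊎ ((u ≡ᵇ redirect i j w) ∧ A w) ≡ true →
      B u ≡ true ⊎ Σ ℕ λ x → x < suc w × u ≡ redirect i j x × A x ≡ true
    forth (inj₁ p) with to (next-true w u) p
    ... | inj₁ b = inj₁ b
    ... | inj₂ (x , x<w , p) = inj₂ (x , m<n⇒m<1+n x<w , p)
    forth (inj₂ p) with e , a ← to ∧-true p = inj₂ (w , ≤-refl , ≡ᵇ⇒≡ u _ (from T-≡ e) , a)
    back : (B u ≡ true ⊎ Σ ℕ λ x → x < suc w × u ≡ redirect i j x × A x ≡ true) →
      next w u ≡ true ⊎ ((u ≡ᵇ redirect i j w) ∧ A w) ≡ true
    back (inj₁ b) = inj₁ (from (next-true w u) (inj₁ b))
    back (inj₂ (x , x<1+w , e , a)) with m≤n⇒m<n∨m≡n (≤-pred x<1+w)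
    ... | inj₁ x<w  = inj₁ (from (next-true w u) (inj₂ (x , x<w , e , a)))
    ... | inj₂ refl = inj₂ (from ∧-true (≡ᵇ-true e , a))

  carry-true : ∀ w → (carry w ≡ true) ⇔
    (Σ ℕ λ x → x < w × Last i j x × A x ≡ true × next x (redirect i j x) ≡ true)
  carry-true zero    = mk⇔ (λ ()) (λ ())
  carry-true (suc w) = ∨-true ⇔∘ mk⇔ forth back
    where
    forth : carry w ≡ true ⊎ (does (last? i j w) ∧ (A w ∧ next w (redirect i j w))) ≡ true →
      Σ ℕ λ x → x < suc w × Last i j x × A x ≡ true × next x (redirect i j x) ≡ true
    forth (inj₁ p) with x , x<w , q ← to (carry-true w) p = x , m<n⇒m<1+n x<w , q
    forth (inj₂ p) with l , p ← to (∧-true {does (last? i j w)}) p with a , o ← to ∧-true p =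
      w , ≤-refl , does-true (last? i j w) l , a , o
    back : (Σ ℕ λ x → x < suc w × Last i j x × A x ≡ true × next x (redirect i j x) ≡ true) →
      carry w ≡ true ⊎ (does (last? i j w) ∧ (A w ∧ next w (redirect i j w))) ≡ true
    back (x , x<1+w , l , a , o) with m≤n⇒m<n∨m≡n (≤-pred x<1+w)
    ... | inj₁ x<w  = inj₁ (from (carry-true w) (x , x<w , l , a , o))
    ... | inj₂ refl = inj₂ (from (∧-true {does (last? i j x)}) (dec-true (last? i j x) l , from ∧-true (a , o)))

module _ (m : ℕ) (V : ℕ → Bool) where

  nextLayer carried : ℕ → ℕ → ℕ → Bool
  nextLayer i j = GateLayer.next i j V (λ _ → false) m
  carried i j u = (u ≡ᵇ i) ∧ GateLayer.carry i j V (λ _ → false) m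

  nextLayer-true : ∀ i j u → (nextLayer i j u ≡ true) ⇔ (Σ ℕ λ x → x < m × u ≡ redirect i j x × V x ≡ true)
  nextLayer-true i j u = GateLayer.next-true i j V (λ _ → false) m u ⇔∘ mk⇔ [ (λ ()) , id ] inj₂

  gate-or : ∀ {i j} → i < m → j < m → nextLayer i j j ≡ V i ∨ V j
  gate-or {i} {j} i<m j<m = bool-ext (nextLayer-true i j j ⇔∘ (mk⇔ forth back ⇔∘ ⇔-sym ∨-true))
    where
    forth : (Σ ℕ λ x → x < m × j ≡ redirect i j x × V x ≡ true) → V i ≡ true ⊎ V j ≡ true
    forth (x , _ , e , v) with x ≟ i
    ... | yes refl = inj₁ v
    ... | no x≢i   = inj₂ (trans (cong V (trans e (redirect-≢ i j x≢i))) v)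
    back : V i ≡ true ⊎ V j ≡ true → Σ ℕ λ x → x < m × j ≡ redirect i j x × V x ≡ true
    back (inj₁ v) = i , i<m , sym (redirect-≡ i j) , v
    back (inj₂ v) with j ≟ i
    ... | yes refl = j , j<m , sym (redirect-≡ i j) , v
    ... | no j≢i   = j , j<m , sym (redirect-≢ i j j≢i) , v

  gate-other : ∀ {i j u} → u < m → u ≢ i → u ≢ j → nextLayer i j u ≡ V u
  gate-other {i} {j} {u} u<m u≢i u≢j = bool-ext (nextLayer-true i j u ⇔∘ mk⇔ forth
    (λ v → u , u<m , sym (redirect-≢ i j u≢i) , v))
    where
    forth : (Σ ℕ λ x → x < m × u ≡ redirect i j x × V x ≡ true) → V u ≡ true
    forth (x , _ , e , v) with x ≟ i
    ... | yes refl = ⊥-elim (u≢j (trans e (redirect-≡ i j)))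
    ... | no x≢i   = trans (cong V (trans e (redirect-≢ i j x≢i))) v

  -- Row `i` would be the only one aimed at node `i`, and it is diverted to `j`. The empty place
  -- lets the later disjunction with the carried value give the conjunction exactly.
  gate-vacated : ∀ {i j} → i ≢ j → nextLayer i j i ≡ false
  gate-vacated {i} {j} i≢j = ¬-not (none ∘ to (nextLayer-true i j i))
    where
    none : ¬ Σ ℕ λ x → x < m × i ≡ redirect i j x × V x ≡ true
    none (x , _ , e , _) with x ≟ i
    ... | yes refl = i≢j (trans e (redirect-≡ i j))
    ... | no x≢i   = x≢i (sym (trans e (redirect-≢ i j x≢i)))

  -- Only rows `i` and `j` are aimed at node `j`. When the later of them arrives, the node is taken
  -- precisely if the earlier row was pushed, that is, if its wire carries 1.
  carry-and : ∀ {i j} → i < m → j < m → i ≢ j → GateLayer.carry i j V (λ _ → false) m ≡ V i ∧ V j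
  carry-and {i} {j} i<m j<m i≢j = bool-ext (carry-true m ⇔∘ (mk⇔ forth back ⇔∘ ⇔-sym ∧-true))
    where
    open GateLayer i j V (λ _ → false)
    forth : (Σ ℕ λ x → x < m × Last i j x × V x ≡ true × next x (redirect i j x) ≡ true) → V i ≡ true × V j ≡ true
    forth (_ , _ , inj₁ (refl , _) , v , o) with to (next-true i (redirect i j i)) o
    ... | inj₂ (x , x<i , e , v′) = v , trans (cong V (trans (sym (redirect-≡ i j)) (trans e (redirect-≢ i j (<⇒≢ x<i))))) v′
    forth (_ , _ , inj₂ (refl , _) , v , o) with to (next-true j (redirect i j j)) o
    ... | inj₂ (x , x<j , e , v′) with x ≟ i
    ...   | yes refl = v′ , v
    ...   | no x≢i   = ⊥-elim (<⇒≢ x<j (trans (sym (redirect-≢ i j x≢i)) (trans (sym e) (redirect-≢ i j (i≢j ∘ sym)))))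
    back : V i ≡ true × V j ≡ true → Σ ℕ λ x → x < m × Last i j x × V x ≡ true × next x (redirect i j x) ≡ true
    back (vi , vj) with <-cmp i j
    ... | tri< i<j _ _ = j , j<m , inj₂ (refl , i<j) , vj , from (next-true j _)
            (inj₂ (i , i<j , trans (redirect-≢ i j (i≢j ∘ sym)) (sym (redirect-≡ i j)) , vi))
    ... | tri≈ _ e _   = ⊥-elim (i≢j e)
    ... | tri> _ _ j<i = i , i<m , inj₁ (refl , j<i) , vi , from (next-true i _)
            (inj₂ (j , j<i , trans (redirect-≡ i j) (sym (redirect-≢ i j (i≢j ∘ sym))) , vj))

  carried-same : ∀ {i} u → carried i i u ≡ false
  carried-same {i} u = trans (cong ((u ≡ᵇ i) ∧_) (¬-not λ p →
    let _ , _ , l , _ = to (GateLayer.carry-true i i V _ m) p in ¬Last-same l)) (∧-zeroʳ (u ≡ᵇ i))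

  carried-other : ∀ {i j u} → u ≢ i → carried i j u ≡ false
  carried-other {i} {j} u≢i = cong (_∧ GateLayer.carry i j V (λ _ → false) m) (≡ᵇ-false u≢i)

  -- At each wire one disjunct vanishes: for i ≠ j wire `i` gets its value from the carried part,
  -- and every other wire from the next layer. For i = j nothing is carried.
  gateStep-layers : ∀ {i j} u → i < m → j < m → u < m → carried i j u ∨ nextLayer i j u ≡ gateStep i j V u
  gateStep-layers {i} {j} u i<m j<m u<m with u ≟ j | i ≟ j
  ... | yes refl | yes refl = trans (cong₂ _∨_ (carried-same j) (gate-or i<m j<m)) (sym (gateStep-or i j V))
  ... | yes refl | no i≢j   =
    trans (cong₂ _∨_ (carried-other {i} {j} (i≢j ∘ sym)) (gate-or i<m j<m)) (sym (gateStep-or i j V))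
  ... | no u≢j   | i≟j with u ≟ i
  ...   | no u≢i = trans (cong₂ _∨_ (carried-other {i} {j} u≢i) (gate-other u<m u≢i u≢j)) (sym (gateStep-other i j V u≢i u≢j))
  ...   | yes refl = trans (cong₂ _∨_ (cong₂ _∧_ (≡ᵇ-true {u} refl) (carry-and i<m j<m u≢j)) (gate-vacated u≢j))
          (trans (∨-identityʳ _) (sym (gateStep-and u j V u≢j)))

even-or-odd : ∀ k → Σ ℕ λ t → k ≡ t + t ⊎ k ≡ suc (t + t)
even-or-odd zero = 0 , inj₁ refl
even-or-odd (suc k) with even-or-odd k
... | t , inj₁ refl = t , inj₂ refl
... | t , inj₂ refl = suc t , inj₁ (cong suc (sym (+-suc t t)))

-- `I` and `J` are indexed by layers, not by gates: even layers hold the gates and odd layers hold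
-- idle ones. Row block k + 1 starts from the nodes of layer k, and block 0 writes the input.
module LayeredGraph
  (m G : ℕ) (I J : ℕ → ℕ) (inp : ℕ → Bool) (adj : ℕ → ℕ → Bool)
  (I<m : ∀ k → k < G + G → I k < m) (J<m : ∀ k → k < G + G → J k < m)
  (odd-trivial : ∀ t → I (suc (t + t)) ≡ J (suc (t + t)))
  (input-row   : ∀ w c → w < m → c < suc (G + G) * m → (adj w c ≡ true) ⇔ (c ≡ w × inp w ≡ true))
  (gate-row    : ∀ k w c → k < G + G → w < m → c < suc (G + G) * m → (adj (suc k * m + w) c ≡ true) ⇔ Edge m k (I k) (J k) w c)
  where

  H N : ℕ
  H = G + G
  N = suc H * m

  layer-< : ∀ {l l′ u} u′ → l < l′ → u < m → l * m + u < l′ * m + u′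
  layer-< {l′ = l′} u′ l<l′ u<m = ≤-trans (position-bound l<l′ u<m) (m≤m+n (l′ * m) u′)

  Edge-column : ∀ {k i j w l u} → i < m → j < m → w < m → u < m → Edge m k i j w (l * m + u) →
    (l ≡ k × u ≡ w) ⊎ (l ≡ suc k × u ≡ redirect i j w) ⊎ (Last i j w × l ≡ suc (suc k) × u ≡ i)
  Edge-column {k} {i} {j} {w} {l} i<m j<m w<m u<m = λ where
    (inj₁ e)              → inj₁ (position-unique m l k u<m w<m e)
    (inj₂ (inj₁ e))       → inj₂ (inj₁ (position-unique m l (suc k) u<m (redirect-< {i = i} j<m w<m) e))
    (inj₂ (inj₂ (l′ , e))) → inj₂ (inj₂ (l′ , position-unique m l (suc (suc k)) u<m i<m e))

  -- `B` records values carried ahead by an earlier gate. The guard in `ahead` covers the last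
  -- layer, which has no successor in the graph.
  record Layer (k : ℕ) (A B T : ℕ → Bool) : Set where
    field
      now   : ∀ u → u < m → T (k * m + u) ≡ A u
      ahead : ∀ u → u < m → suc k * m + u < N → T (suc k * m + u) ≡ B u
      rest  : ∀ c → suc (suc k) * m ≤ c → c < N → T c ≡ false

  Layer-cong : ∀ {k A B A′ B′ T} → (∀ u → u < m → A u ≡ A′ u) → (∀ u → u < m → B u ≡ B′ u) → Layer k A B T → Layer k A′ B′ T
  Layer-cong eA eB S = record
    { now   = λ u u<m → trans (now u u<m) (eA u u<m)
    ; ahead = λ u u<m c<N → trans (ahead u u<m c<N) (eB u u<m)
    ; rest  = rest
    }
    where open Layer S

  module Phase (k : ℕ) (k<H : k < H) (A B : ℕ → Bool) where

    i j : ℕ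
    i = I k
    j = J k

    i<m : i < m
    i<m = I<m k k<H

    j<m : j < m
    j<m = J<m k k<H

    open GateLayer i j A B

    -- A row whose own value node is free takes it, which erases the 0 stored there. Hence `now`
    -- speaks only of rows still to be processed.
    record During (w : ℕ) (T : ℕ → Bool) : Set where
      field
        now   : ∀ u → w ≤ u → u < m → T (k * m + u) ≡ A u
        after : ∀ u → u < m → T (suc k * m + u) ≡ next w u
        top   : ∀ u → u < m → suc (suc k) * m + u < N → T (suc (suc k) * m + u) ≡ (u ≡ᵇ i) ∧ carry w
        far   : ∀ c → suc (suc (suc k)) * m ≤ c → c < N → T c ≡ false

    module Step (w : ℕ) (w<m : w < m) (T : ℕ → Bool) (D : During w T) where
      open During D

      f : ℕ → Bool
      f = adj (suc k * m + w)

      σ s a b : ℕ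
      σ = redirect i j w
      s = k * m + w
      a = suc k * m + σ
      b = suc (suc k) * m + i

      σ<m : σ < m
      σ<m = redirect-< {i = i} j<m w<m

      s<a : s < a
      s<a = layer-< {k} {suc k} σ ≤-refl w<m

      a<b : a < b
      a<b = layer-< {suc k} {suc (suc k)} i ≤-refl σ<m

      now<N : ∀ {u} → u < m → k * m + u < N
      now<N u<m = position-bound (m<n⇒m<1+n k<H) u<m

      after<N : ∀ {u} → u < m → suc k * m + u < N
      after<N u<m = position-bound (s<s k<H) u<m

      unaffected : ∀ c → c < N → ¬ Edge m k i j w c → matchRow f T c ≡ T c
      unaffected c c<N ¬E = matchRow-skip f T c (¬-not (¬E ∘ to (gate-row k w c k<H w<m c<N)))

      unaffected-column : ∀ l u → u < m → l * m + u < N →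
        ¬ ((l ≡ k × u ≡ w) ⊎ (l ≡ suc k × u ≡ σ) ⊎ (Last i j w × l ≡ suc (suc k) × u ≡ i)) →
        matchRow f T (l * m + u) ≡ T (l * m + u)
      unaffected-column l u u<m c<N ¬E = unaffected (l * m + u) c<N (¬E ∘ Edge-column {l = l} i<m j<m w<m u<m)

      edge : ∀ {c} → c < N → Edge m k i j w c → f c ≡ true
      edge c<N = from (gate-row k w _ k<H w<m c<N)

      edge⁻ : ∀ {c} → c < N → f c ≡ true → Edge m k i j w c
      edge⁻ c<N = to (gate-row k w _ k<H w<m c<N)

      now′ : ∀ u → suc w ≤ u → u < m → matchRow f T (k * m + u) ≡ A u
      now′ u w<u u<m = trans (unaffected-column k u u<m (now<N u<m) λ where
        (inj₁ (_ , refl))          → <-irrefl refl w<u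
        (inj₂ (inj₁ (e , _)))      → m≢1+n+m k {0} e
        (inj₂ (inj₂ (_ , e , _)))  → m≢1+n+m k {1} e) (now u (<⇒≤ w<u) u<m)

      after′ : ∀ u → u < m → matchRow f T (suc k * m + u) ≡ next (suc w) u
      after′ u u<m with u ≟ σ
      ... | yes refl = trans
        (matchRow-second f T s<a (edge (now<N w<m) (inj₁ refl)) (edge (after<N σ<m) (inj₂ (inj₁ refl))) only)
        (cong₂ _∨_ (after σ σ<m) (trans (now w ≤-refl w<m) (cong (_∧ A w) (sym (≡ᵇ-true {σ} refl)))))
        where
        only : ∀ x → x < a → f x ≡ true → x ≡ s
        only x x<a fx with edge⁻ (<-trans x<a (after<N σ<m)) fx
        ... | inj₁ e                = e
        ... | inj₂ (inj₁ refl)      = ⊥-elim (<-irrefl refl x<a)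
        ... | inj₂ (inj₂ (_ , refl)) = ⊥-elim (<-asym x<a a<b)
      ... | no u≢σ = trans (unaffected-column (suc k) u u<m (after<N u<m) λ where
          (inj₁ (e , _))            → 1+n≢n e
          (inj₂ (inj₁ (_ , e)))     → u≢σ e
          (inj₂ (inj₂ (_ , e , _))) → 1+n≢n (sym e))
        (trans (after u u<m) (sym (∨-falseʳ (cong (_∧ A w) (≡ᵇ-false u≢σ)))))

      top′ : ∀ u → u < m → suc (suc k) * m + u < N →
        matchRow f T (suc (suc k) * m + u) ≡ (u ≡ᵇ i) ∧ carry (suc w)
      top′ u u<m c<N with u ≟ i
      ... | no u≢i = trans (unaffected-column (suc (suc k)) u u<m c<N λ where
          (inj₁ (e , _))            → m≢1+n+m k {1} (sym e)
          (inj₂ (inj₁ (e , _)))     → 1+n≢n e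
          (inj₂ (inj₂ (_ , _ , e))) → u≢i e)
        (trans (top u u<m c<N) (trans (cong (_∧ carry w) (≡ᵇ-false u≢i)) (cong (_∧ carry (suc w)) (sym (≡ᵇ-false u≢i)))))
      ... | yes refl with last? i j w in dec
      ...   | no ¬l = trans (unaffected-column (suc (suc k)) u u<m c<N λ where
          (inj₁ (e , _))            → m≢1+n+m k {1} (sym e)
          (inj₂ (inj₁ (e , _)))     → 1+n≢n e
          (inj₂ (inj₂ (l , _)))     → ¬l l)
        (trans (top u u<m c<N) (cong ((u ≡ᵇ i) ∧_)
          (sym (∨-falseʳ (cong (_∧ (A w ∧ next w σ)) (dec-false (last? i j w) ¬l))))))
      ...   | yes l = trans
        (matchRow-third f T s<a a<b (edge (now<N w<m) (inj₁ refl)) (edge (after<N σ<m) (inj₂ (inj₁ refl)))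
          (edge c<N (inj₂ (inj₂ (l , refl)))) only)
        (trans (cong₂ _∨_ (trans (top u u<m c<N) (cong (_∧ carry w) (≡ᵇ-true {u} refl)))
                          (cong₂ _∧_ (now w ≤-refl w<m) (after σ σ<m)))
          (trans (cong (carry w ∨_) (cong (_∧ (A w ∧ next w σ)) (sym (dec-true (last? i j w) l))))
            (cong (_∧ carry (suc w)) (sym (≡ᵇ-true {u} refl)))))
        where
        only : ∀ x → x < b → f x ≡ true → x ≡ s ⊎ x ≡ a
        only x x<b fx with edge⁻ (<-trans x<b c<N) fx
        ... | inj₁ e                 = inj₁ e
        ... | inj₂ (inj₁ e)          = inj₂ e
        ... | inj₂ (inj₂ (_ , refl)) = ⊥-elim (<-irrefl refl x<b)

      far′ : ∀ c → suc (suc (suc k)) * m ≤ c → c < N → matchRow f T c ≡ false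
      far′ c 3≤c c<N = trans (unaffected c c<N λ where
        (inj₁ refl)                → <⇒≱ (position-bound (m≤n⇒m≤1+n (n≤1+n (suc k))) w<m) 3≤c
        (inj₂ (inj₁ refl))         → <⇒≱ (position-bound (n≤1+n (suc (suc k))) σ<m) 3≤c
        (inj₂ (inj₂ (_ , refl)))   → <⇒≱ (position-bound {suc (suc (suc k))} ≤-refl i<m) 3≤c) (far c 3≤c c<N)

      during : During (suc w) (matchRow f T)
      during = record { now = now′ ; after = after′ ; top = top′ ; far = far′ }

    rowsDone : ℕ → ℕ → Bool
    rowsDone w = matched adj (suc k * m + w)

    during : ∀ w → w ≤ m → Layer k A B (rowsDone 0) → During w (rowsDone w)
    during zero    _   S = record
      { now   = λ u _ → now u
      ; after = λ u u<m → ahead u u<m (position-bound (s<s k<H) u<m)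
      ; top   = λ u u<m c<N → trans (rest _ (m≤m+n _ u) c<N) (sym (∧-zeroʳ (u ≡ᵇ i)))
      ; far   = λ c 3≤c → rest c (≤-trans (m≤n+m (suc (suc k) * m) m) 3≤c)
      }
      where open Layer S
    during (suc w) w<m S = subst (During (suc w)) (cong (matched adj) (sym (+-suc (suc k * m) w)))
      (Step.during w w<m (rowsDone w) (during w (<⇒≤ w<m) S))

    phase : Layer k A B (matched adj (suc k * m)) →
      Layer (suc k) (next m) (λ u → (u ≡ᵇ i) ∧ carry m) (matched adj (suc (suc k) * m))
    phase S = subst (Layer (suc k) (next m) (λ u → (u ≡ᵇ i) ∧ carry m)) (cong (matched adj) (+-comm (suc k * m) m))
      (record { now = after ; ahead = top ; rest = far })
      where
      open During (during m ≤-refl (subst (Layer k A B) (cong (matched adj) (sym (+-identityʳ (suc k * m)))) S))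

  -- Row `w` has no neighbour but `w`, and has that one exactly when the input bit is 1, so nothing
  -- can interfere between the rows of this block.
  input-rows : ∀ w → w ≤ m →
    (∀ u → u < w → matched adj w u ≡ inp u) × (∀ c → w ≤ c → c < N → matched adj w c ≡ false)
  input-rows zero    _   = (λ _ ()) , λ _ _ _ → refl
  input-rows (suc w) w<m with done , pending ← input-rows w (<⇒≤ w<m) = done′ , pending′
    where
    m≤N : m ≤ N
    m≤N = m≤m+n m (H * m)
    T : ℕ → Bool
    T = matched adj w
    skip : ∀ c → c < N → c ≢ w → matchRow (adj w) T c ≡ T c
    skip c c<N c≢w = matchRow-skip (adj w) T c (¬-not (c≢w ∘ proj₁ ∘ to (input-row w c w<m c<N)))
    w<N : w < N
    w<N = ≤-trans w<m m≤N
    own : matchRow (adj w) T w ≡ inp w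
    own with inp w in e
    ... | true  = trans (matchRow-take (adj w) T w (from (input-row w w w<m w<N) (refl , e))
                    (from (allBelow-true w) (λ x x<w → from ∨-true (inj₁ (from not-true
                      (<⇒≢ x<w ∘ proj₁ ∘ to (input-row w x w<m (<-trans x<w w<N)))))))) (∨-zeroʳ (T w))
    ... | false = trans (matchRow-skip (adj w) T w (¬-not λ a → not-¬ (proj₂ (to (input-row w w w<m w<N) a)) e))
                    (pending w ≤-refl w<N)
    done′ : ∀ u → u < suc w → matchRow (adj w) T u ≡ inp u
    done′ u u<1+w with m≤n⇒m<n∨m≡n (≤-pred u<1+w)
    ... | inj₁ u<w  = trans (skip u (<-trans u<w w<N) (<⇒≢ u<w)) (done u u<w)
    ... | inj₂ refl = own
    pending′ : ∀ c → suc w ≤ c → c < N → matchRow (adj w) T c ≡ false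
    pending′ c w<c c<N = trans (skip c c<N (>⇒≢ w<c)) (pending c (<⇒≤ w<c) c<N)

  trivial-next : ∀ i j A B u → i ≡ j → u < m → GateLayer.next i j A B m u ≡ B u ∨ A u
  trivial-next i _ A B u refl u<m = bool-ext (GateLayer.next-true i i A B m u ⇔∘ (mk⇔
    [ inj₁ , (λ (x , _ , e , a) → inj₂ (trans (cong A (trans e (redirect-same i x))) a)) ]
    [ inj₁ , (λ a → inj₂ (u , u<m , sym (redirect-same i u) , a)) ] ⇔∘ ⇔-sym ∨-true))

  trivial-carry : ∀ i j A B → i ≡ j → GateLayer.carry i j A B m ≡ false
  trivial-carry i _ A B refl = ¬-not λ p → let _ , _ , l , _ = to (GateLayer.carry-true i i A B m) p in ¬Last-same l

  V : ℕ → ℕ → Bool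
  V = run (λ t → I (t + t)) (λ t → J (t + t)) inp

  layers : ∀ t → t ≤ G → Layer (t + t) (V t) (λ _ → false) (matched adj (suc (t + t) * m))
  layers zero    _   = subst (Layer 0 inp (λ _ → false)) (cong (matched adj) (sym (+-identityʳ m)))
    (record { now = proj₁ (input-rows m ≤-refl)
            ; ahead = λ u u<m → pending _ (m≤n⇒m≤n+o u (m≤m+n m 0))
            ; rest = λ c 2≤c → pending c (≤-trans (m≤m+n m (m + 0)) 2≤c) })
    where
    pending = proj₂ (input-rows m ≤-refl)
  layers (suc t) t<G rewrite +-suc t t = Layer-cong
    -- The idle phase ORs the layer it reads into what was carried ahead, which is the left side of
    -- `gateStep-layers`.
    (λ u u<m → trans (trivial-next (I (suc (t + t))) (J (suc (t + t))) _ _ u (odd-trivial t) u<m)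
      (gateStep-layers m (V t) u (I<m (t + t) 2t<H) (J<m (t + t) 2t<H) u<m))
    (λ u _ → trans (cong ((u ≡ᵇ I (suc (t + t))) ∧_) (trivial-carry _ _ _ _ (odd-trivial t))) (∧-zeroʳ (u ≡ᵇ I (suc (t + t)))))
    (Phase.phase (suc (t + t)) 1+2t<H _ _ (Phase.phase (t + t) 2t<H _ _ (layers t (<⇒≤ t<G))))
    where
    1+2t<H : suc (t + t) < H
    1+2t<H = subst (_≤ H) (cong suc (+-suc t t)) (+-mono-≤ t<G t<G)
    2t<H : t + t < H
    2t<H = <⇒≤ 1+2t<H

  -- The last block of rows reads layer H - 1, so no row starts from layer H and its values survive
  -- to the end.
  matched-run : ∀ d → d < m → matched adj N (H * m + d) ≡ V G d
  matched-run = Layer.now (layers G ≤-refl)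

  -- Otherwise a node could be redirected to by one gate and carried to by the previous one, which
  -- would give it a fourth neighbour.
  parity-trivial : ∀ k → I k ≡ J k ⊎ I (suc k) ≡ J (suc k)
  parity-trivial k with even-or-odd k
  ... | t , inj₁ refl = inj₂ (odd-trivial t)
  ... | t , inj₂ refl = inj₁ (odd-trivial t)

  row-degree : ∀ r → r < N → Σ ℕ λ a → Σ ℕ λ b → Σ ℕ λ c → Covers N (adj r) a b c
  row-degree r r<N with split-position (suc H) m r r<N
  ... | zero  , _        , w , w<m , refl = w , w , w , λ x x<N e → inj₁ (proj₁ (to (input-row w x w<m x<N) e))
  ... | suc k , s≤s k<H  , w , w<m , refl = k * m + w , suc k * m + redirect (I k) (J k) w , suc (suc k) * m + I k
      , λ x x<N e → [ inj₁ , [ inj₂ ∘ inj₁ , inj₂ ∘ inj₂ ∘ proj₂ ] ] (to (gate-row k w x k<H w<m x<N) e)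

  -- A column (l , u) meets the rows (l , u) and (l + 1 , u); the third neighbour comes from the one
  -- nontrivial gate among the layers l − 2 and l − 1.
  extra : ℕ → ℕ
  extra zero    = 0
  extra (suc k) = if does (I k ≟ J k) then back k else suc k * m + I k
    where
    back : ℕ → ℕ
    back zero    = 0
    back (suc k) = suc k * m + (I k ⊔ J k)

  extra-redirected : ∀ k → I k ≢ J k → extra (suc k) ≡ suc k * m + I k
  extra-redirected k e rewrite dec-false (I k ≟ J k) e = refl

  extra-carried : ∀ k → I k ≢ J k → extra (suc (suc k)) ≡ suc k * m + (I k ⊔ J k)
  extra-carried k e with parity-trivial k
  ... | inj₁ e′ = ⊥-elim (e e′)
  ... | inj₂ e′ rewrite dec-true (I (suc k) ≟ J (suc k)) e′ = refl

  Last-≢ : ∀ {i j w} → Last i j w → i ≢ j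
  Last-≢ l refl = ¬Last-same l

  Last-⊔ : ∀ {i j w} → Last i j w → w ≡ i ⊔ j
  Last-⊔ (inj₁ (refl , j<i)) = sym (m≥n⇒m⊔n≡m (<⇒≤ j<i))
  Last-⊔ (inj₂ (refl , i<j)) = sym (m≤n⇒m⊔n≡n (<⇒≤ i<j))

  column-covers : ∀ l u → u < m → l * m + u < N → Covers N (λ r → adj r (l * m + u)) (l * m + u) (suc l * m + u) (extra l)
  column-covers l u u<m c<N r r<N e with split-position (suc H) m r r<N
  ... | zero  , _       , w , w<m , refl = inj₁ (sym (proj₁ (to (input-row w (l * m + u) w<m c<N) e)))
  ... | suc k , s≤s k<H , w , w<m , refl
    with Edge-column {k} {I k} {J k} {w} {l} {u} (I<m k k<H) (J<m k k<H) w<m u<m (to (gate-row k w (l * m + u) k<H w<m c<N) e)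
  ...   | inj₁ (refl , refl) = inj₂ (inj₁ refl)
  ...   | inj₂ (inj₂ (last , refl , refl)) =
    inj₂ (inj₂ (trans (cong (suc k * m +_) (Last-⊔ last)) (sym (extra-carried k (Last-≢ last)))))
  ...   | inj₂ (inj₁ (refl , refl)) with w ≟ I k | I k ≟ J k
  ...     | no w≢i   | _      = inj₁ (cong (suc k * m +_) (sym (redirect-≢ (I k) (J k) w≢i)))
  ...     | yes _    | yes eq = inj₁ (cong (suc k * m +_) (sym (trans (cong (λ j → redirect (I k) j w) (sym eq)) (redirect-same (I k) w))))
  ...     | yes refl | no i≢j = inj₂ (inj₂ (sym (extra-redirected k i≢j)))

  column-degree : ∀ x → x < N → Σ ℕ λ a → Σ ℕ λ b → Σ ℕ λ c → Covers N (λ r → adj r x) a b c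
  column-degree x x<N with l , _ , u , u<m , refl ← split-position (suc H) m x x<N = _ , _ , _ , column-covers l u u<m x<N

  -- The covering indices found above may lie outside the graph, as at the last layers. Capping them
  -- at `N` bounds them and alters none that covers an index below `N`.
  low-degree : ∀ {K} → N < K → Degree≤3 K N N adj
  low-degree {K} N<K = (λ r r<N → clip (row-degree r r<N)) , λ x x<N → clip (column-degree x x<N)
    where
    below : ∀ a → a ⊓ N < K
    below a = ≤-<-trans (m⊓n≤n a N) N<K
    clipped : ∀ {x a} → x < N → x ≡ a → x ≡ a ⊓ N
    clipped x<N refl = sym (m≤n⇒m⊓n≡m (<⇒≤ x<N))
    clip : ∀ {f} → (Σ ℕ λ a → Σ ℕ λ b → Σ ℕ λ c → Covers N f a b c) →
      Σ ℕ λ a → a < K × Σ ℕ λ b → b < K × Σ ℕ λ c → c < K × Covers N f a b c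
    clip (a , b , c , cov) = a ⊓ N , below a , b ⊓ N , below b , c ⊓ N , below c
      , λ x x<N e → Sum.map (clipped x<N) (Sum.map (clipped x<N) (clipped x<N)) (cov x x<N e)

-- The layered graph as a definable list

inputRowᶠ : Fm 5
inputRowᶠ = q ≐ w ∧ᶠ bitᶠ (m ⊞ lit 1 ⊞ w)
  where
  q w m : Term 5
  q = var (# 0)
  w = var (# 1)
  m = var (# 4)

-- The endpoints of gate t are guessed and checked against a single bit of each word of the input;
-- this suffices because the words are one-hot. The case distinction on w = i spells out `redirect`.
gateRowᶠ copyRowᶠ : Fm 6
gateRowᶠ = ∃< (var (# 5)) (∃< (var (# 6)) (bitᶠ (gate ⊞ i) ∧ᶠ bitᶠ (gate ⊞ m ⊞ j) ∧ᶠ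
  ( q ≐ (t ⊞ t) ⊠ m ⊞ w
  ∨ᶠ w ≐ i ∧ᶠ q ≐ (lit 1 ⊞ (t ⊞ t)) ⊠ m ⊞ j
  ∨ᶠ ¬ᶠ (w ≐ i) ∧ᶠ q ≐ (lit 1 ⊞ (t ⊞ t)) ⊠ m ⊞ w
  ∨ᶠ (w ≐ i ∧ᶠ j ≺ i ∨ᶠ w ≐ j ∧ᶠ i ≺ j) ∧ᶠ q ≐ (lit 2 ⊞ (t ⊞ t)) ⊠ m ⊞ i)))
  where
  j i q w t m gate : Term 8
  j = var (# 0)
  i = var (# 1)
  q = var (# 2)
  w = var (# 3)
  t = var (# 4)
  m = var (# 7)
  gate = m ⊞ lit 1 ⊞ m ⊞ m ⊞ t ⊠ (m ⊞ m)
copyRowᶠ = q ≐ (lit 1 ⊞ (t ⊞ t)) ⊠ m ⊞ w ∨ᶠ q ≐ (lit 2 ⊞ (t ⊞ t)) ⊠ m ⊞ w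
  where
  q w t m : Term 6
  q = var (# 0)
  w = var (# 1)
  t = var (# 2)
  m = var (# 5)

graphOf : DefList 3
graphOf = tabᴸ N ⊤ᶠ ++ᴸ tabᴸ (lit 1) ⊥ᶠ ++ᴸ tabᴸ N ⊤ᶠ ++ᴸ tabᴸ (lit 1) ⊥ᶠ ++ᴸ tabᴸ N (var zero ≐ wkT ((G ⊞ G) ⊠ m ⊞ d))
  ++ᴸ blocksᴸ m N (tabᴸ (wkT N) inputRowᶠ) (λ _ _ _ → refl)
  -- Gate rows and copy rows of one gate form a single block, so all blocks have equal length; they
  -- become row blocks 2t + 1 and 2t + 2.
  ++ᴸ blocksᴸ G (m ⊠ N ⊞ m ⊠ N)
        (blocksᴸ (wkT m) (wkT N) (tabᴸ (wkT (wkT N)) gateRowᶠ) (λ _ _ _ → refl)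
         ++ᴸ blocksᴸ (wkT m) (wkT N) (tabᴸ (wkT (wkT N)) copyRowᶠ) (λ _ _ _ → refl))
        (λ _ _ _ → refl)
  where
  d G m N : Term 3
  d = var zero
  G = var (suc zero)
  m = var (suc (suc zero))
  N = (lit 1 ⊞ G ⊞ G) ⊠ m

-- Spreads the gates over the even layers. The value 0 at odd layers, used for both endpoints, is
-- the idle gate (0 , 0); wire 0 exists because d < m.
onEven : (ℕ → ℕ) → ℕ → ℕ
onEven f zero          = f 0
onEven f (suc zero)    = 0
onEven f (suc (suc k)) = onEven (f ∘ suc) k

onEven-even : ∀ f t → onEven f (t + t) ≡ f t
onEven-even f zero    = refl
onEven-even f (suc t) rewrite +-suc t t = onEven-even (f ∘ suc) t

onEven-odd : ∀ f t → onEven f (suc (t + t)) ≡ 0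
onEven-odd f zero    = refl
onEven-odd f (suc t) rewrite +-suc t t = onEven-odd (f ∘ suc) t

half-< : ∀ {t G} → t + t < G + G → t < G
half-< {t} {G} 2t<2G = ≰⇒> λ G≤t → <⇒≱ 2t<2G (+-mono-≤ G≤t G≤t)

module GraphOf {X m G d} (sh : CShape X m G d) where

  H N : ℕ
  H = G + G
  N = suc H * m

  Y : List Bool
  Y = list graphOf (d ∷ G ∷ m ∷ []) X

  d<m : d < m
  d<m = let _ , _ , p , _ = sh in p

  gateAt : ∀ t → t < G → Σ ℕ λ i → i < m × Σ ℕ λ j → j < m × GateAt X m t i j
  gateAt = let _ , _ , _ , _ , g , _ = sh in g

  wires : ℕ → ℕ × ℕ
  wires t with t <? G
  ... | yes t<G = let i , _ , j , _ = gateAt t t<G in i , j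
  ... | no  _   = 0 , 0

  I J I½ J½ : ℕ → ℕ
  I t = proj₁ (wires t)
  J t = proj₂ (wires t)
  I½ = onEven I
  J½ = onEven J

  wires-ok : ∀ t → t < G → I t < m × J t < m × GateAt X m t (I t) (J t)
  wires-ok t t<G with t <? G
  ... | yes t<G = let i , i<m , j , j<m , g = gateAt t t<G in i<m , j<m , g
  ... | no  t≮G = ⊥-elim (t≮G t<G)

  onEven-< : ∀ f → (∀ t → t < G → f t < m) → ∀ k → k < H → onEven f k < m
  onEven-< f f<m k k<H with even-or-odd k
  ... | t , inj₁ refl = subst (_< m) (sym (onEven-even f t)) (f<m t (half-< k<H))
  ... | t , inj₂ refl = subst (_< m) (sym (onEven-odd f t)) (≤-<-trans z≤n d<m)

  env₅ : ℕ → ℕ → Vec ℕ 5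
  env₅ q w = q ∷ w ∷ d ∷ G ∷ m ∷ []

  env₆ : ℕ → ℕ → ℕ → Vec ℕ 6
  env₆ q w t = q ∷ w ∷ t ∷ d ∷ G ∷ m ∷ []

  inputRow : ℕ → List Bool
  inputRow w = applyUpTo (λ q → evalF (compile inputRowᶠ) (env₅ q w) X) N

  layerRow : Fm 6 → ℕ → ℕ → List Bool
  layerRow φ t w = applyUpTo (λ q → evalF (compile φ) (env₆ q w t) X) N

  rows : (ℕ → List Bool) → List Bool
  rows f = concat (applyUpTo f m)

  rows-length : ∀ φ t → length (rows (layerRow φ t)) ≡ m * N
  rows-length φ t = concat-length m N (layerRow φ t) (λ _ _ → length-applyUpTo _ N)

  layer-length : ∀ t → length (rows (layerRow gateRowᶠ t) ++ rows (layerRow copyRowᶠ t)) ≡ m * N + m * N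
  layer-length t = trans (length-++ (rows (layerRow gateRowᶠ t))) (cong₂ _+_ (rows-length gateRowᶠ t) (rows-length copyRowᶠ t))

  matrix : List Bool
  matrix = rows inputRow ++ concat (applyUpTo (λ t → rows (layerRow gateRowᶠ t) ++ rows (layerRow copyRowᶠ t)) G)

  record Pieces : Set where
    field
      prefix₁ : Ones Y 0 N
      zero₁   : ¬ bitAt Y N ≡ true
      prefix₂ : Ones Y (N + 1) N
      zero₂   : ¬ bitAt Y (N + 1 + N) ≡ true
      output  : OneHot Y (N + 1 + N + 1) N (H * m + d)
      body    : At Y (gOffset N N) matrix

  pieces : Pieces
  pieces with a₁ , a ← to (At-++ _ (length-applyUpTo _ N)) (At-self Y)
    with a₂ , a ← to (At-++ (false ∷ []) refl) a
    with a₃ , a ← to (At-++ _ (length-applyUpTo _ N)) a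
    with a₄ , a ← to (At-++ (false ∷ []) refl) a
    with a₅ , a ← to (At-++ _ (length-applyUpTo _ N)) a = record
    { prefix₁ = At-applyUpTo N a₁
    ; zero₁   = to At-zero a₂
    ; prefix₂ = At-applyUpTo N a₃
    ; zero₂   = to At-zero a₄
    ; output  = tab-OneHot a₅ (λ q → compile-⟦⟧ (var (# 0) ≐ (var (# 2) ⊞ var (# 2)) ⊠ var (# 3) ⊞ var (# 1)) {q ∷ d ∷ G ∷ m ∷ []} {X})
    ; body    = a
    }

  open Pieces pieces

  adj : ℕ → ℕ → Bool
  adj = adjBit Y N N

  input-body : At Y (gOffset N N) (rows inputRow)
  input-body = proj₁ (to (At-++ (rows inputRow) (concat-length m N inputRow (λ _ _ → length-applyUpTo _ N))) body)

  layer-body : ∀ t → t < G → At Y (gOffset N N + m * N + t * (m * N + m * N))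
    (rows (layerRow gateRowᶠ t) ++ rows (layerRow copyRowᶠ t))
  layer-body = At-concat G layer-length
    (proj₂ (to (At-++ (rows inputRow) (concat-length m N inputRow (λ _ _ → length-applyUpTo _ N))) body))

  input-bit : ∀ w c → w < m → c < N → adj w c ≡ evalF (compile inputRowᶠ) (env₅ c w) X
  input-bit w c w<m c<N = At-applyUpTo N (At-concat m (λ _ → length-applyUpTo _ N) input-body w w<m) c c<N

  gate-bit : ∀ t w c → t < G → w < m → c < N → adj (suc (t + t) * m + w) c ≡ evalF (compile gateRowᶠ) (env₆ c w t) X
  gate-bit t w c t<G w<m c<N = trans (cong (λ k → bitAt Y (k + c)) (sym (offset (gOffset N N) m N t w)))
    (At-applyUpTo N (At-concat m (λ _ → length-applyUpTo _ N)
      (proj₁ (to (At-++ (rows (layerRow gateRowᶠ t)) (rows-length gateRowᶠ t)) (layer-body t t<G))) w w<m) c c<N)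
    where
    offset : ∀ k m x t w → k + m * x + t * (m * x + m * x) + w * x ≡ k + (suc (t + t) * m + w) * x
    offset = solve-∀

  copy-bit : ∀ t w c → t < G → w < m → c < N → adj (suc (suc (t + t)) * m + w) c ≡ evalF (compile copyRowᶠ) (env₆ c w t) X
  copy-bit t w c t<G w<m c<N = trans (cong (λ k → bitAt Y (k + c)) (sym (offset (gOffset N N) m N t w)))
    (At-applyUpTo N (At-concat m (λ _ → length-applyUpTo _ N)
      (proj₂ (to (At-++ (rows (layerRow gateRowᶠ t)) (rows-length gateRowᶠ t)) (layer-body t t<G))) w w<m) c c<N)
    where
    offset : ∀ k m x t w → k + m * x + t * (m * x + m * x) + m * x + w * x ≡ k + (suc (suc (t + t)) * m + w) * x
    offset = solve-∀

  ⟦gateRow⟧ : ∀ t w c → t < G → ⟦ gateRowᶠ ⟧ (env₆ c w t) X ⇔ Edge m (t + t) (I t) (J t) w c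
  ⟦gateRow⟧ t w c t<G = mk⇔ forth back
    where
    ok = wires-ok t t<G
    I<m = proj₁ ok
    J<m = proj₁ (proj₂ ok)
    hotI = proj₁ (proj₂ (proj₂ ok))
    hotJ = proj₂ (proj₂ (proj₂ ok))
    forth : ⟦ gateRowᶠ ⟧ (env₆ c w t) X → Edge m (t + t) (I t) (J t) w c
    forth (i , i<m , j , j<m , bi , bj , e) with proj₁ (hotI i i<m) bi | proj₁ (hotJ j j<m) bj | e
    ... | refl | refl | inj₁ e                       = inj₁ e
    ... | refl | refl | inj₂ (inj₁ (refl , e))       = inj₂ (inj₁ (trans e (cong (suc (t + t) * m +_) (sym (redirect-≡ w (J t))))))
    ... | refl | refl | inj₂ (inj₂ (inj₁ (w≢i , e))) = inj₂ (inj₁ (trans e (cong (suc (t + t) * m +_) (sym (redirect-≢ (I t) (J t) w≢i)))))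
    ... | refl | refl | inj₂ (inj₂ (inj₂ (l , e)))   = inj₂ (inj₂ (l , e))
    back : Edge m (t + t) (I t) (J t) w c → ⟦ gateRowᶠ ⟧ (env₆ c w t) X
    back E = I t , I<m , J t , J<m , proj₂ (hotI (I t) I<m) refl , proj₂ (hotJ (J t) J<m) refl , body′ E
      where
      body′ : Edge m (t + t) (I t) (J t) w c → _
      body′ (inj₁ e)        = inj₁ e
      body′ (inj₂ (inj₂ p)) = inj₂ (inj₂ (inj₂ p))
      body′ (inj₂ (inj₁ e)) with w ≟ I t
      ... | yes w≡I = inj₂ (inj₁ (w≡I , trans e (cong (suc (t + t) * m +_) (trans (cong (redirect (I t) (J t)) w≡I) (redirect-≡ (I t) (J t))))))
      ... | no  w≢I = inj₂ (inj₂ (inj₁ (w≢I , trans e (cong (suc (t + t) * m +_) (redirect-≢ (I t) (J t) w≢I)))))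

  ⟦copyRow⟧ : ∀ t w c → ⟦ copyRowᶠ ⟧ (env₆ c w t) X ⇔ Edge m (suc (t + t)) 0 0 w c
  ⟦copyRow⟧ t w c = mk⇔
    [ inj₁ , (λ e → inj₂ (inj₁ (trans e (cong (suc (suc (t + t)) * m +_) (sym (redirect-same 0 w)))))) ]
    [ inj₁ , [ (λ e → inj₂ (trans e (cong (suc (suc (t + t)) * m +_) (redirect-same 0 w)))) , (λ (l , _) → ⊥-elim (¬Last-same l)) ] ]

  ≡-⇔ : ∀ {a b} → a ≡ b → (a ≡ true) ⇔ (b ≡ true)
  ≡-⇔ refl = mk⇔ id id

  gate-row : ∀ k w c → k < H → w < m → c < N → (adj (suc k * m + w) c ≡ true) ⇔ Edge m k (I½ k) (J½ k) w c
  gate-row k w c k<H w<m c<N with even-or-odd k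
  ... | t , inj₁ refl = subst₂ (λ i j → _ ⇔ Edge m (t + t) i j w c) (sym (onEven-even I t)) (sym (onEven-even J t))
    (≡-⇔ (gate-bit t w c t<G w<m c<N) ⇔∘ (compile-⟦⟧ gateRowᶠ {env₆ c w t} {X} ⇔∘ ⟦gateRow⟧ t w c t<G))
    where
    t<G = half-< k<H
  ... | t , inj₂ refl = subst₂ (λ i j → _ ⇔ Edge m (suc (t + t)) i j w c) (sym (onEven-odd I t)) (sym (onEven-odd J t))
    (≡-⇔ (copy-bit t w c (half-< (<⇒≤ k<H)) w<m c<N) ⇔∘ (compile-⟦⟧ copyRowᶠ {env₆ c w t} {X} ⇔∘ ⟦copyRow⟧ t w c))

  input-row : ∀ w c → w < m → c < N → (adj w c ≡ true) ⇔ (c ≡ w × inputBit X m w ≡ true)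
  input-row w c w<m c<N = ≡-⇔ (input-bit w c w<m c<N) ⇔∘ compile-⟦⟧ inputRowᶠ {env₅ c w} {X}

  open LayeredGraph m G I½ J½ (inputBit X m) adj
    (onEven-< I (λ t t<G → proj₁ (wires-ok t t<G))) (onEven-< J (λ t t<G → proj₁ (proj₂ (wires-ok t t<G))))
    (λ t → trans (onEven-odd I t) (sym (onEven-odd J t))) input-row gate-row
    using (matched-run; low-degree)

  Y-length : length Y ≡ gOffset N N + N * N
  Y-length = trans (length-list graphOf (d ∷ G ∷ m ∷ []) X) (assoc N m G)
    where
    assoc : ∀ N m G → N + (1 + (N + (1 + (N + (m * N + G * (m * N + m * N)))))) ≡ N + 1 + N + 1 + N + suc (G + G) * m * N
    assoc = solve-∀

  Y-shape : GShape Y N N (H * m + d)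
  Y-shape = prefix₁ , zero₁ , prefix₂ , zero₂ , position-bound {suc H} ≤-refl d<m , output , Y-length

  correct : CCV X ⇔ V3LFMM Y
  correct = CCV-semantics {X} sh (λ t → I½ (t + t)) (λ t → J½ (t + t)) gates
    ⇔∘ (≡-⇔ (sym (matched-run d d<m)) ⇔∘ (⇔-sym (VLFMM-semantics {Y} Y-shape) ⇔∘ mk⇔
      (λ V → from (V3LFMM⇔ {Y} Y-shape) (low-degree (GShape-m< {Y} Y-shape) , V)) V3LFMM⇒VLFMM))
    where
    gates : ∀ t → t < G → I½ (t + t) < m × J½ (t + t) < m × GateAt X m t (I½ (t + t)) (J½ (t + t))
    gates t t<G = subst₂ (λ i j → i < m × j < m × GateAt X m t i j) (sym (onEven-even I t)) (sym (onEven-even J t)) (wires-ok t t<G)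

CShape-bounded : ∀ {X m G d} → CShape X m G d → ∀ i → lookup (d ∷ G ∷ m ∷ []) i < length X
CShape-bounded {X} {m} {G} {d} (_ , _ , d<m , _ , _ , l) = bound
  where
  shift : ∀ m x → suc (m + m + m) + x ≡ m + 1 + m + m + x
  shift = solve-∀
  shift′ : ∀ m x → m + suc (m + m + x) ≡ m + 1 + m + m + x
  shift′ = solve-∀
  m<X : m < length X
  m<X = subst (m <_) (trans (shift′ m (G * (m + m))) (sym l)) (m<m+n m z<s)
  G<X : G < length X
  -- As d < m, every gate occupies at least one bit, so the gate part alone has length at least G.
  G<X = subst (G <_) (sym l) (≤-<-trans (m≤m*n G (m + m) {{>-nonZero (≤-trans (≤-<-trans z≤n d<m) (m≤m+n m m))}})
    (subst (G * (m + m) <_) (shift m (G * (m + m))) (m<n+m (G * (m + m)) z<s)))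
  bound : ∀ i → lookup (d ∷ G ∷ m ∷ []) i < length X
  bound zero             = <-trans d<m m<X
  bound (suc zero)       = G<X
  bound (suc (suc zero)) = m<X

CCV≤V3LFMM : CCV ≤AC0 V3LFMM
CCV≤V3LFMM = Reduction.reduction {CCV} {V3LFMM} cShape graphOf
  (λ { X (d ∷ G ∷ m ∷ []) sh → CShape-bounded {X} sh })
  unique
  (λ X C → let m , G , d , sh = CCV-shape C in d ∷ G ∷ m ∷ [] , sh)
  (¬VLFMM-[] ∘ V3LFMM⇒VLFMM)
  (λ { X (d ∷ G ∷ m ∷ []) sh → GraphOf.correct {X} sh })
  where
  unique : ∀ X ρ ρ′ → ⟦ cShape ⟧ ρ X → ⟦ cShape ⟧ ρ′ X → ρ ≡ ρ′
  unique X (d ∷ G ∷ m ∷ []) (d′ ∷ G′ ∷ m′ ∷ []) sh sh′ with refl , refl , refl ← CShape-unique {X} sh sh′ = refl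

theorem32 : (CCV ≡AC0 V3LFMM) × (V3LFMM ≡AC0 VLFMM) × (CCV ≡AC0 VLFMM)
theorem32 =
    (CCV≤V3LFMM , ≤AC0-trans {V3LFMM} {VLFMM} {CCV} V3LFMM≤VLFMM VLFMM≤CCV)
  , (V3LFMM≤VLFMM , ≤AC0-trans {VLFMM} {CCV} {V3LFMM} VLFMM≤CCV CCV≤V3LFMM)
  , (≤AC0-trans {CCV} {V3LFMM} {VLFMM} CCV≤V3LFMM V3LFMM≤VLFMM , VLFMM≤CCV)
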